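{- Let $C_0\geq 3\times 10^3$ be an absolute constant and let $k\geq 2$, $r\geq 0$ be fixed integers. Let $n\geq C_0(r+1)^3(k+r)k^{2}$ and $\delta\in\left[\frac{150k^3(r+1)^2}{n},\,1-\frac{150k^3(r+1)^3}{n}\right]\cup\{1\}$. If $\mathcal{F}\subseteq\binom{[n]}{k}$ satisfies $|\mathcal{F}|=\sum_{i=1}^{r}\binom{n-i}{k-1}+\delta\binom{n-(r+1)}{k-1}$ and $\mathcal{I}(\mathcal{F})=\mathcal{MI}(\mathcal{F})$, then, up to isomorphism, $$\mathcal{L}_{n,k,1}^{(r)}\subseteq \mathcal{F}\subseteq \mathcal{L}_{n,k,1}^{(r+1)}.$$
   Context: $[n]=\{1,\dots,n\}$ and $\binom{[n]}{k}$ is the family of all $k$-subsets of $[n]$. For $\mathcal{F}\subseteq\binom{[n]}{k}$ and $x\in[n]$, $\mathcal{F}(x)=\{F\in\mathcal{F}: x\in F\}$. The total intersection of $\mathcal{F}$ is $\mathcal{I}(\mathcal{F})=\sum_{A\in\mathcal{F}}\sum_{B\in\mathcal{F}}|A\cap B|=\sum_{x\in[n]}|\mathcal{F}(x)|^2$ (sum over ordered pairs, including $A=B$), and $\mathcal{MI}(\mathcal{F})=\max\{\mathcal{I}(\mathcal{G}):\mathcal{G}\subseteq\binom{[n]}{k},\ |\mathcal{G}|=|\mathcal{F}|\}$. Lexicographic order on $\binom{[n]}{k}$: $F_1$ comes before $F_2$ if the minimal element of the symmetric difference $F_1\Delta F_2$ lies in $F_1$. For $t\geq 1$, $r\ge 0$,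 $\mathcal{L}_{n,k,t}^{(r)}$ denotes the family of the first $\binom{n-t+1}{k-t+1}-\binom{n-(t+r-1)}{k-t+1}$ $k$-subsets of $[n]$ in lexicographic order. "Up to isomorphism" means: there is a permutation $\sigma$ of $[n]$ such that $\mathcal{L}_{n,k,1}^{(r)}\subseteq \{\sigma(F):F\in\mathcal{F}\}\subseteq\mathcal{L}_{n,k,1}^{(r+1)}$. -}

module Defs where

open import Data.Bool using (Bool; true; false; _∧_; if_then_else_)
open import Data.Nat using (ℕ; zero; suc; _+_; _*_; _∸_; _^_; _≤_; _<_; _≡ᵇ_; _<ᵇ_)
open import Data.Nat.Combinatorics using (_C_)
open import Data.Fin using (Fin)
open import Data.Fin.Subset using (Subset; _∩_; ∣_∣; inside; outside)
open import Data.Fin.Permutation using (Permutation′; _⟨$⟩ˡ_)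
open import Data.Vec using (Vec; []; _∷_; lookup; tabulate)
open import Data.List using (List; []; _∷_; _++_; map; length; filterᵇ)
open import Data.Nat.ListAction using (sum)
open import Data.List.Relation.Unary.All using (All)
open import Data.List.Relation.Unary.Unique.Propositional using (Unique)
open import Data.List.Membership.Propositional renaming (_∈_ to _∈ₗ_)
open import Data.Product using (Σ; _×_; ∃-syntax)
open import Relation.Binary.PropositionalEquality using (_≡_)

-- A family F ⊆ ([n] choose k): a duplicate-free list of k-subsets of Fin n
-- (element i of Fin n plays the role of i+1 ∈ [n]).
IsFamily : (n k : ℕ) → List (Subset n) → Set
IsFamily n k F = Unique F × All (λ A → ∣ A ∣ ≡ k) F

totalIntersection : {n : ℕ} → List (Subset n) → ℕ
totalIntersection F = sum (map (λ A → sum (map (λ B → ∣ A ∩ B ∣) F)) F)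

-- I(F) = MI(F): I(F) is the maximum of I(G) over all G ⊆ ([n] choose k), |G| = |F|.
-- (F itself is such a G, so this says exactly that F attains the maximum.)
AttainsMI : (n k : ℕ) → List (Subset n) → Set
AttainsMI n k F = ∀ (G : List (Subset n)) → IsFamily n k G → length G ≡ length F →
                  totalIntersection G ≤ totalIntersection F

allSubsets : (n : ℕ) → List (Subset n)
allSubsets zero = [] ∷ []
allSubsets (suc n) = map (inside ∷_) (allSubsets n) ++ map (outside ∷_) (allSubsets n)

lexBefore : {n : ℕ} → Subset n → Subset n → Bool
lexBefore [] [] = false
lexBefore (true ∷ a) (true ∷ b) = lexBefore a b
lexBefore (false ∷ a) (false ∷ b) = lexBefore a b
lexBefore (true ∷ a) (false ∷ b) = true
lexBefore (false ∷ a) (true ∷ b) = false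

rankLex : (n k : ℕ) → Subset n → ℕ
rankLex n k A = length (filterᵇ (λ B → (∣ B ∣ ≡ᵇ k) ∧ lexBefore B A) (allSubsets n))

lexSize : (n k t r : ℕ) → ℕ
lexSize n k t r = ((n ∸ t + 1) C (k ∸ t + 1)) ∸ ((n ∸ (t + r ∸ 1)) C (k ∸ t + 1))

InL : (n k t r : ℕ) → Subset n → Set
InL n k t r A = ∣ A ∣ ≡ k × rankLex n k A < lexSize n k t r

-- Image σ(A) of a subset under a permutation σ of [n]: σ(j) ∈ σ(A) iff j ∈ A.
image : {n : ℕ} → Permutation′ n → Subset n → Subset n
image σ A = tabulate (λ i → lookup A (σ ⟨$⟩ˡ i))

SandwichedUpToIso : (n k r : ℕ) → List (Subset n) → Set
SandwichedUpToIso n k r F =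
  ∃[ σ ] ( (∀ (B : Subset n) → InL n k 1 r B → ∃[ A ] (A ∈ₗ F × image σ A ≡ B))
         × (∀ (A : Subset n) → A ∈ₗ F → InL n k 1 (suc r) (image σ A)) )

sumBinoms : (n k r : ℕ) → ℕ
sumBinoms n k zero = 0
sumBinoms n k (suc r) = sumBinoms n k r + ((n ∸ suc r) C (k ∸ 1))

{-# OPTIONS --safe #-}

-- Write U for the k-subsets of [n], d(x) for degrees in F, and let R be the r elements of largest
-- degree.  Since I(F) = Σ d(x)², exchanging one member of F for a non-member shows that, with
-- w(A) = Σ_{x ∈ A} d(x), no non-member outweighs a member.
-- Let F′ be the part of F avoiding R, e the number of sets of U meeting R but missing from F, so that
-- |F′| = m + e, and let x maximise the degree u in F′.
-- (1) Comparing F with {A : A meets R} plus m sets through x, and bounding Σ deg_{F′}² by means of the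
--     4k(r+1) elements of largest degree (pairs have small codegree), gives 2u > |F′| + small.
-- (2) A member of F avoiding R ∪ {x} would then be lighter than u, hence lighter than every set meeting
--     R ∪ {x}; all of those would lie in F, which is too small for that.  So F′ is contained in the star of x.
-- (3) Comparing F with {A : A meets R} plus m members of F′ shows that, unless e = 0, m is closer to the
--     full degree C(n-1,k-1) than δ < 1 allows; for δ = 1 the star of x has no room for e > 0.

module Submission where

open import Defs
open import Data.Bool using (Bool; true; false; _∧_; _∨_; not; if_then_else_)
open import Data.Bool.Properties using (T-≡; T?; not-injective; ∧-zeroʳ; ∧-identityʳ; ∨-zeroʳ) renaming (_≟_ to _≟ᵇ_)
open import Data.Nat using (ℕ; zero; suc; _+_; _*_; _∸_; _^_; _≤_; _<_; _≡ᵇ_; _<ᵇ_; z≤n; s≤s; NonZero; >-nonZero; >-nonZero⁻¹)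
open import Data.Nat.Properties
open import Data.Nat.Combinatorics using (_C_; nCk+nC[k+1]≡[n+1]C[k+1])
open import Data.Nat.ListAction using (sum)
open import Data.Nat.ListAction.Properties using (sum-++)
open import Data.Nat.Tactic.RingSolver using (solve-∀)
open import Data.Fin using (Fin; zero; suc; toℕ; fromℕ<)
import Data.Fin.Properties as Fin
open import Data.Fin.Properties using (toℕ-fromℕ<; toℕ-injective)
open import Data.Fin.Permutation using (Permutation′; _⟨$⟩ʳ_; _⟨$⟩ˡ_; _∘ₚ_; transpose; id; flip; inverseˡ; inverseʳ)
open import Data.Fin.Subset using (Subset; inside; outside; _∩_; ∣_∣; ⊥)
open import Data.Fin.Subset.Properties using (∣p∣≤n; ∣⊥∣≡0)
open import Data.Vec using ([]; _∷_; lookup; _[_]≔_)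
open import Data.Vec.Properties using (≡-dec; lookup-zipWith; lookup∘update; lookup∘update′; lookup-replicate; lookup∘tabulate; []≔-idempotent; []≔-lookup; tabulate∘lookup; tabulate-cong)
open import Data.List using (List; []; _∷_; _++_; map; length; filterᵇ; allFin)
open import Data.List.Properties using (map-++; map-∘; map-cong; map-tabulate)
open import Data.List.Relation.Unary.All using (All; []; _∷_)
import Data.List.Relation.Unary.All as All
open import Data.List.Relation.Unary.Any using (here; there)
open import Data.List.Relation.Unary.Unique.Propositional using (Unique; []; _∷_)
import Data.List.Relation.Unary.Unique.Propositional.Properties as Unique
open import Data.List.Membership.Propositional using () renaming (_∈_ to _∈ₗ_)
open import Data.List.Membership.Propositional.Properties using (∈-allFin; ∈-filter⁺; ∈-filter⁻; ∈-++⁺ˡ; ∈-++⁺ʳ; ∈-map⁺; ∈-map⁻)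
open import Data.Product using (_×_; _,_; proj₁; proj₂; ∃-syntax)
open import Data.Sum using (_⊎_; inj₁; inj₂)
open import Function using (_∘_; Equivalence)
open import Relation.Nullary using (¬_; yes; no; does; contradiction)
open import Relation.Binary.Definitions using (DecidableEquality)
open import Relation.Binary.PropositionalEquality

-- Nothing bounds `e` in advance, so F′ may be far larger than m and every estimate must hold
-- uniformly in `e`. What pays for a large `e` is this: a point of R missing η of its sets has
-- degree d = D - η, and d ≥ u because R carries the largest degrees; restoring those sets raises
-- its square by η(D + d) ≥ η(D + u). Every missing set meets R, so both comparisons contain a term
-- (D + u)e, which offsets the growth of Σ deg_{F′}² caused by |F′| = m + e. The interaction with
-- the sets meeting R is harmless: all points outside R have the same degree in that family. Errors
-- are measured in multiples of β = k²s²K, where s = r + 1 and K is the codegree of a pair. Since nK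
-- ≤ kD, the lower bound on δ yields 100β ≤ m; the constant 150 is 100 times 3/2, a factor lost in
-- passing from D to C(n-s,k-1) ≥ 2D/3.

private variable
  X Y : Set

-- Finite sums over lists

∑ : List X → (X → ℕ) → ℕ
∑ xs f = sum (map f xs)

infix 5 ∑
syntax ∑ xs (λ x → e) = ∑[ x ∈ xs ] e

𝟙 : Bool → ℕ
𝟙 false = 0
𝟙 true  = 1

∑-cong : ∀ (xs : List X) {f g : X → ℕ} → (∀ x → f x ≡ g x) → ∑ xs f ≡ ∑ xs g
∑-cong xs f≗g = cong sum (map-cong f≗g xs)

∑-mono-∈ : ∀ (xs : List X) {f g : X → ℕ} → (∀ x → x ∈ₗ xs → f x ≤ g x) → ∑ xs f ≤ ∑ xs g
∑-mono-∈ []       f≤g = z≤n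
∑-mono-∈ (x ∷ xs) f≤g = +-mono-≤ (f≤g x (here refl)) (∑-mono-∈ xs λ y y∈xs → f≤g y (there y∈xs))

∑-mono : ∀ (xs : List X) {f g : X → ℕ} → (∀ x → f x ≤ g x) → ∑ xs f ≤ ∑ xs g
∑-mono xs f≤g = ∑-mono-∈ xs λ x _ → f≤g x

∑-cong-∈ : ∀ (xs : List X) {f g : X → ℕ} → (∀ x → x ∈ₗ xs → f x ≡ g x) → ∑ xs f ≡ ∑ xs g
∑-cong-∈ xs f≡g = ≤-antisym (∑-mono-∈ xs λ x i → ≤-reflexive (f≡g x i))
                            (∑-mono-∈ xs λ x i → ≤-reflexive (sym (f≡g x i)))

∑-+ : ∀ (xs : List X) (f g : X → ℕ) → ∑[ x ∈ xs ] (f x + g x) ≡ ∑ xs f + ∑ xs g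
∑-+ []       f g = refl
∑-+ (x ∷ xs) f g = trans (cong (f x + g x +_) (∑-+ xs f g)) (+-+-swap (f x) (g x) (∑ xs f) (∑ xs g))
  where
  +-+-swap : ∀ a b c d → a + b + (c + d) ≡ a + c + (b + d)
  +-+-swap = solve-∀

∑-*ˡ : ∀ (xs : List X) c (f : X → ℕ) → ∑[ x ∈ xs ] (c * f x) ≡ c * ∑ xs f
∑-*ˡ []       c f = sym (*-zeroʳ c)
∑-*ˡ (x ∷ xs) c f = trans (cong (c * f x +_) (∑-*ˡ xs c f)) (sym (*-distribˡ-+ c (f x) (∑ xs f)))

∑-*ʳ : ∀ (xs : List X) (f : X → ℕ) c → ∑[ x ∈ xs ] (f x * c) ≡ ∑ xs f * c
∑-*ʳ xs f c = trans (∑-cong xs λ x → *-comm (f x) c) (trans (∑-*ˡ xs c f) (*-comm c (∑ xs f)))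

∑-0 : ∀ (xs : List X) → ∑[ x ∈ xs ] 0 ≡ 0
∑-0 []       = refl
∑-0 (x ∷ xs) = ∑-0 xs

∑-swap : ∀ (xs : List X) (ys : List Y) (f : X → Y → ℕ) →
         ∑[ x ∈ xs ] ∑[ y ∈ ys ] f x y ≡ ∑[ y ∈ ys ] ∑[ x ∈ xs ] f x y
∑-swap []       ys f = sym (∑-0 ys)
∑-swap (x ∷ xs) ys f = trans (cong (∑ ys (f x) +_) (∑-swap xs ys f)) (sym (∑-+ ys (f x) _))

∑-++ : ∀ (xs ys : List X) (f : X → ℕ) → ∑ (xs ++ ys) f ≡ ∑ xs f + ∑ ys f
∑-++ xs ys f = trans (cong sum (map-++ f xs ys)) (sum-++ (map f xs) (map f ys))

∑-map : ∀ (h : X → Y) (xs : List X) (f : Y → ℕ) → ∑ (map h xs) f ≡ ∑ xs (f ∘ h)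
∑-map h xs f = cong sum (sym (map-∘ xs))

∑-filter : ∀ (q : X → Bool) (xs : List X) (f : X → ℕ) → ∑ (filterᵇ q xs) f ≡ ∑[ x ∈ xs ] (𝟙 (q x) * f x)
∑-filter q []       f = refl
∑-filter q (x ∷ xs) f with q x
... | true  = cong₂ _+_ (sym (+-identityʳ (f x))) (∑-filter q xs f)
... | false = ∑-filter q xs f

∑-length : ∀ (xs : List X) → length xs ≡ ∑[ x ∈ xs ] 1
∑-length []       = refl
∑-length (x ∷ xs) = cong suc (∑-length xs)

∑-∈ : ∀ {xs : List X} (f : X → ℕ) {x} → x ∈ₗ xs → f x ≤ ∑ xs f
∑-∈ f (here refl)  = m≤m+n _ _
∑-∈ f (there x∈xs) = ≤-trans (∑-∈ f x∈xs) (m≤n+m _ _)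

module _ (_≟_ : DecidableEquality X) where

  ∑-δ-∉ : ∀ {xs : List X} {x} (f : X → ℕ) → All (x ≢_) xs → ∑[ y ∈ xs ] (𝟙 (does (y ≟ x)) * f y) ≡ 0
  ∑-δ-∉ f []                = refl
  ∑-δ-∉ {y ∷ xs} {x} f (x≢y ∷ x∉xs) with y ≟ x
  ... | yes y≡x = contradiction (sym y≡x) x≢y
  ... | no  _   = ∑-δ-∉ f x∉xs

  ∑-δ : ∀ {xs : List X} {x} (f : X → ℕ) → Unique xs → x ∈ₗ xs → ∑[ y ∈ xs ] (𝟙 (does (y ≟ x)) * f y) ≡ f x
  ∑-δ {y ∷ xs} {x} f (y∉xs ∷ _) (here x≡y) with y ≟ x
  ... | yes refl = trans (cong₂ _+_ (+-identityʳ (f x)) (∑-δ-∉ f y∉xs)) (+-identityʳ (f x))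
  ... | no  y≢x  = contradiction (sym x≡y) y≢x
  ∑-δ {y ∷ xs} {x} f (y∉xs ∷ u) (there x∈xs) with y ≟ x
  ... | yes refl = contradiction refl (All.lookup y∉xs x∈xs)
  ... | no  _    = ∑-δ f u x∈xs

∑-allFin-suc : ∀ {n} (f : Fin (suc n) → ℕ) → ∑ (allFin (suc n)) f ≡ f zero + ∑ (allFin n) (f ∘ suc)
∑-allFin-suc {n} f = cong (λ l → f zero + sum l)
  (trans (map-tabulate suc f) (sym (map-tabulate (λ i → i) (f ∘ suc))))

∑-const : ∀ n c → ∑[ i ∈ allFin n ] c ≡ n * c
∑-const zero    c = refl
∑-const (suc n) c = trans (∑-allFin-suc {n} (λ _ → c)) (cong (c +_) (∑-const n c))

-- Indicators, and sets meeting a given set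

𝟙-∧ : ∀ a b → 𝟙 (a ∧ b) ≡ 𝟙 a * 𝟙 b
𝟙-∧ false b = refl
𝟙-∧ true  b = sym (+-identityʳ (𝟙 b))

𝟙-mono : ∀ {a b} → (a ≡ true → b ≡ true) → 𝟙 a ≤ 𝟙 b
𝟙-mono {false} _ = z≤n
𝟙-mono {true}  h = ≤-reflexive (cong 𝟙 (sym (h refl)))

∧⁻ : ∀ a {b} → a ∧ b ≡ true → a ≡ true × b ≡ true
∧⁻ true b = refl , b

∣∣-∑ : ∀ {n} (A : Subset n) → ∣ A ∣ ≡ ∑[ j ∈ allFin n ] 𝟙 (lookup A j)
∣∣-∑ []          = refl
∣∣-∑ (true ∷ A)  = trans (cong suc (∣∣-∑ A)) (sym (∑-allFin-suc (𝟙 ∘ lookup (true ∷ A))))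
∣∣-∑ (false ∷ A) = trans (∣∣-∑ A) (sym (∑-allFin-suc (𝟙 ∘ lookup (false ∷ A))))

∣∩∣-∑ : ∀ {n} (A B : Subset n) → ∣ A ∩ B ∣ ≡ ∑[ j ∈ allFin n ] (𝟙 (lookup A j) * 𝟙 (lookup B j))
∣∩∣-∑ A B = trans (∣∣-∑ (A ∩ B)) (∑-cong (allFin _) λ j →
  trans (cong 𝟙 (lookup-zipWith _∧_ j A B)) (𝟙-∧ (lookup A j) (lookup B j)))

hit : ∀ {n} → Subset n → Subset n → Bool
hit []      []      = false
hit (s ∷ S) (a ∷ A) = (s ∧ a) ∨ hit S A

hit⁺ : ∀ {n} (S A : Subset n) j → lookup S j ≡ true → lookup A j ≡ true → hit S A ≡ true
hit⁺ (true ∷ S) (true ∷ A) zero    _   _   = refl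
hit⁺ (s ∷ S)    (a ∷ A)    (suc j) S∋j A∋j with s ∧ a
... | true  = refl
... | false = hit⁺ S A j S∋j A∋j

hit⁻ : ∀ {n} (S A : Subset n) → hit S A ≡ true → ∃[ j ] (lookup S j ≡ true × lookup A j ≡ true)
hit⁻ []          []          ()
hit⁻ (true ∷ S)  (true ∷ A)  _ = zero , refl , refl
hit⁻ (true ∷ S)  (false ∷ A) h = let j , p , q = hit⁻ S A h in suc j , p , q
hit⁻ (false ∷ S) (a ∷ A)     h = let j , p , q = hit⁻ S A h in suc j , p , q

hit-∉ : ∀ {n} (S A : Subset n) j → hit S A ≡ false → lookup S j ≡ true → lookup A j ≡ false
hit-∉ S A j ¬h S∋j with lookup A j in eq
... | false = refl
... | true  = trans (sym (hit⁺ S A j S∋j eq)) ¬h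

insert : ∀ {n} → Fin n → Subset n → Subset n
insert x S = S [ x ]≔ true

hit-insert : ∀ {n} x (S A : Subset n) → hit (insert x S) A ≡ lookup A x ∨ hit S A
hit-insert zero    (false ∷ S) (a ∷ A) = refl
hit-insert zero    (true ∷ S)  (true ∷ A) = refl
hit-insert zero    (true ∷ S)  (false ∷ A) = refl
hit-insert (suc x) (s ∷ S)     (a ∷ A) rewrite hit-insert x S A with s ∧ a | lookup A x
... | true  | true  = refl
... | true  | false = refl
... | false | _     = refl

∣insert∣ : ∀ {n} x (S : Subset n) → lookup S x ≡ false → ∣ insert x S ∣ ≡ suc ∣ S ∣
∣insert∣ zero    (false ∷ S) _   = refl
∣insert∣ (suc x) (true ∷ S)  S∌x = cong suc (∣insert∣ x S S∌x)
∣insert∣ (suc x) (false ∷ S) S∌x = ∣insert∣ x S S∌x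

hit-⊥ : ∀ {n} (A : Subset n) → hit ⊥ A ≡ false
hit-⊥ []      = refl
hit-⊥ (a ∷ A) = hit-⊥ A

-- Enumeration of the k-subsets and binomial counts

_≟ₛ_ : ∀ {n} → DecidableEquality (Subset n)
_≟ₛ_ = ≡-dec _≟ᵇ_

allSubsets-complete : ∀ {n} (A : Subset n) → A ∈ₗ allSubsets n
allSubsets-complete []          = here refl
allSubsets-complete (true ∷ A)  = ∈-++⁺ˡ (∈-map⁺ (inside ∷_) (allSubsets-complete A))
allSubsets-complete {suc n} (false ∷ A) =
  ∈-++⁺ʳ (map (inside ∷_) (allSubsets n)) (∈-map⁺ (outside ∷_) (allSubsets-complete A))

allSubsets-unique : ∀ n → Unique (allSubsets n)
allSubsets-unique zero    = [] ∷ []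
allSubsets-unique (suc n) = Unique.++⁺ (Unique.map⁺ (λ { refl → refl }) (allSubsets-unique n))
                                       (Unique.map⁺ (λ { refl → refl }) (allSubsets-unique n)) disjoint
  where
  disjoint : ∀ {A} → ¬ (A ∈ₗ map (inside ∷_) (allSubsets n) × A ∈ₗ map (outside ∷_) (allSubsets n))
  disjoint (A∈ , A∈′) with ∈-map⁻ (inside ∷_) A∈ | ∈-map⁻ (outside ∷_) A∈′
  ... | _ , _ , refl | _ , _ , ()

kSubsets : ∀ n → ℕ → List (Subset n)
kSubsets n k = filterᵇ (λ A → ∣ A ∣ ≡ᵇ k) (allSubsets n)

∈-kSubsets⁺ : ∀ {n k} {A : Subset n} → ∣ A ∣ ≡ k → A ∈ₗ kSubsets n k
∈-kSubsets⁺ {n} {k} {A} ∣A∣≡k = ∈-filter⁺ (T? ∘ λ A → ∣ A ∣ ≡ᵇ k) (allSubsets-complete A) (≡⇒≡ᵇ _ _ ∣A∣≡k)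

∈-kSubsets⁻ : ∀ {n k} {A : Subset n} → A ∈ₗ kSubsets n k → ∣ A ∣ ≡ k
∈-kSubsets⁻ {n} {k} {A} A∈U = ≡ᵇ⇒≡ _ _ (proj₂ (∈-filter⁻ (T? ∘ λ A → ∣ A ∣ ≡ᵇ k) {xs = allSubsets n} A∈U))

kSubsets-unique : ∀ n k → Unique (kSubsets n k)
kSubsets-unique n k = Unique.filter⁺ (T? ∘ λ A → ∣ A ∣ ≡ᵇ k) (allSubsets-unique n)

∑-allSubsets-suc : ∀ n (f : Subset (suc n) → ℕ) →
  ∑ (allSubsets (suc n)) f ≡ (∑[ A ∈ allSubsets n ] f (true ∷ A)) + (∑[ A ∈ allSubsets n ] f (false ∷ A))
∑-allSubsets-suc n f = trans (∑-++ (map (inside ∷_) (allSubsets n)) _ f)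
  (cong₂ _+_ (∑-map (inside ∷_) (allSubsets n) f) (∑-map (outside ∷_) (allSubsets n) f))

-- Coordinate by coordinate this is Pascal's rule: a coordinate in `S` forces `outside` and leaves
-- `q` alone, a coordinate not in `S` splits on membership and lowers `q`. Giving `q` by an equation
-- keeps truncated subtraction out of the induction.
∑-avoid : ∀ {n} (S : Subset n) q k → ∣ S ∣ + q ≡ n →
          ∑[ A ∈ allSubsets n ] (𝟙 (∣ A ∣ ≡ᵇ k) * 𝟙 (not (hit S A))) ≡ q C k
∑-avoid []          zero    zero    _  = refl
∑-avoid []          zero    (suc k) _  = refl
∑-avoid {suc n} (true ∷ S) q k eq = trans (∑-allSubsets-suc n _) (cong₂ _+_
  (trans (∑-cong (allSubsets n) λ A → *-zeroʳ (𝟙 (suc ∣ A ∣ ≡ᵇ k))) (∑-0 (allSubsets n)))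
  (∑-avoid S q k (suc-injective eq)))
∑-avoid {suc n} (false ∷ S) zero k eq =
  contradiction (≤-trans (≤-reflexive (trans (sym eq) (+-identityʳ ∣ S ∣))) (∣p∣≤n S)) (<-irrefl refl)
∑-avoid {suc n} (false ∷ S) (suc q) zero eq = trans (∑-allSubsets-suc n _) (cong₂ _+_ (∑-0 (allSubsets n))
  (∑-avoid S q zero (suc-injective (trans (sym (+-suc ∣ S ∣ q)) eq))))
∑-avoid {suc n} (false ∷ S) (suc q) (suc k) eq = trans (∑-allSubsets-suc n _) (trans (cong₂ _+_
  (∑-avoid S q k eq′) (∑-avoid S q (suc k) eq′)) (nCk+nC[k+1]≡[n+1]C[k+1] q k))
  where eq′ = suc-injective (trans (sym (+-suc ∣ S ∣ q)) eq)

-- Pascal's rule telescopes. It identifies the sum as the number of sets meeting a fixed `s`-set,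
-- complementary to the `(n ∸ s) C suc k` sets avoiding it.
sumBinoms-C : ∀ n k s → s ≤ n → sumBinoms n (suc k) s + (n ∸ s) C suc k ≡ n C suc k
sumBinoms-C n k zero    _   = refl
sumBinoms-C n k (suc s) s<n = begin
  sumBinoms n (suc k) s + (n ∸ suc s) C k + (n ∸ suc s) C suc k   ≡⟨ +-assoc (sumBinoms n (suc k) s) _ _ ⟩
  sumBinoms n (suc k) s + ((n ∸ suc s) C k + (n ∸ suc s) C suc k) ≡⟨ cong (sumBinoms n (suc k) s +_) (nCk+nC[k+1]≡[n+1]C[k+1] (n ∸ suc s) k) ⟩
  sumBinoms n (suc k) s + suc (n ∸ suc s) C suc k                 ≡⟨ cong (λ q → sumBinoms n (suc k) s + q C suc k) (sym (+-∸-assoc 1 s<n)) ⟩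
  sumBinoms n (suc k) s + (n ∸ s) C suc k                         ≡⟨ sumBinoms-C n k s (<⇒≤ s<n) ⟩
  n C suc k                                                       ∎
  where open ≡-Reasoning

-- Subfamilies of prescribed size and points of largest degree

select : DecidableEquality X → ∀ {xs : List X} → Unique xs → (p : X → Bool) (m : ℕ) → m ≤ ∑[ x ∈ xs ] 𝟙 (p x) →
         ∃[ g ] ((∀ x → g x ≡ true → p x ≡ true) × ∑[ x ∈ xs ] 𝟙 (g x) ≡ m)
select _≟_ {xs} _ p zero _ = (λ _ → false) , (λ _ ()) , ∑-0 xs
select _≟_ {x ∷ xs} (x∉xs ∷ u) p (suc m) m≤ with p x in px
... | false = let g , g⊆p , #g = select _≟_ u p (suc m) m≤ in
  g , g⊆p , trans (cong (λ b → 𝟙 b + _) (¬g g g⊆p)) #g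
  where
  ¬g : ∀ (g : _ → Bool) → (∀ y → g y ≡ true → p y ≡ true) → g x ≡ false
  ¬g g g⊆p with g x in gx
  ... | false = refl
  ... | true  = trans (sym (g⊆p x gx)) px
... | true  = let g , g⊆p , #g = select _≟_ u p m (≤-pred m≤) in
  (λ y → does (y ≟ x) ∨ g y) , sub g g⊆p , cong₂ _+_ (self g) (trans (∑-cong-∈ xs (other g)) #g)
  where
  sub : ∀ (g : _ → Bool) → (∀ y → g y ≡ true → p y ≡ true) → ∀ y → does (y ≟ x) ∨ g y ≡ true → p y ≡ true
  sub g g⊆p y gy with y ≟ x
  ... | yes refl = px
  ... | no _     = g⊆p y gy
  self : ∀ (g : _ → Bool) → 𝟙 (does (x ≟ x) ∨ g x) ≡ 1
  self g with x ≟ x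
  ... | yes _  = refl
  ... | no x≢x = contradiction refl x≢x
  other : ∀ (g : _ → Bool) y → y ∈ₗ xs → 𝟙 (does (y ≟ x) ∨ g y) ≡ 𝟙 (g y)
  other g y y∈xs with y ≟ x
  ... | yes refl = contradiction refl (All.lookup x∉xs y∈xs)
  ... | no _     = refl

argmax : ∀ {n} (T : Subset n) (d : Fin n → ℕ) → (∀ j → lookup T j ≡ true) ⊎
         ∃[ x ] (lookup T x ≡ false × (∀ j → lookup T j ≡ false → d j ≤ d x))
argmax []          d = inj₁ λ ()
argmax (true ∷ T)  d with argmax T (d ∘ suc)
... | inj₁ full          = inj₁ λ { zero → refl ; (suc j) → full j }
... | inj₂ (x , x∉ , max) = inj₂ (suc x , x∉ , λ { (suc j) → max j })
argmax (false ∷ T) d with argmax T (d ∘ suc)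
... | inj₁ full = inj₂ (zero , refl , λ { zero _ → ≤-refl ; (suc j) j∉ → contradiction (trans (sym j∉) (full j)) λ () })
... | inj₂ (x , x∉ , max) with ≤-total (d zero) (d (suc x))
...   | inj₁ ≤x = inj₂ (suc x , x∉ , λ { zero _ → ≤x ; (suc j) → max j })
...   | inj₂ x≤ = inj₂ (zero , refl , λ { zero _ → ≤-refl ; (suc j) j∉ → ≤-trans (max j j∉) x≤ })

argmax-∉ : ∀ {n} (T : Subset n) (d : Fin n → ℕ) → ∣ T ∣ < n →
           ∃[ x ] (lookup T x ≡ false × (∀ j → lookup T j ≡ false → d j ≤ d x))
argmax-∉ {n} T d ∣T∣<n with argmax T d
... | inj₂ r    = r
... | inj₁ full = contradiction ∣T∣<n (<-irrefl (begin
  ∣ T ∣                              ≡⟨ ∣∣-∑ T ⟩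
  (∑[ j ∈ allFin n ] 𝟙 (lookup T j)) ≡⟨ ∑-cong (allFin n) (λ j → cong 𝟙 (full j)) ⟩
  (∑[ j ∈ allFin n ] 1)              ≡⟨ ∑-const n 1 ⟩
  n * 1                              ≡⟨ *-identityʳ n ⟩
  n                                  ∎))
  where open ≡-Reasoning

-- The threshold `v` turns "the largest values" into two numerical bounds, one on `T` and one off
-- `T`; ties are broken arbitrarily.
largest : ∀ {n} (d : Fin n → ℕ) ℓ → ℓ ≤ n →
          ∃[ T ] ∃[ v ] (∣ T ∣ ≡ ℓ × (∀ i → lookup T i ≡ true → v ≤ d i) × (∀ j → lookup T j ≡ false → d j ≤ v))
-- For the empty set any upper bound of `d` will do as threshold; the total is one.
largest {n} d zero    _   = ⊥ , ∑ (allFin n) d , ∣⊥∣≡0 n ,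
  (λ i i∈⊥ → contradiction (trans (sym i∈⊥) (lookup-replicate i false)) λ ()) , λ j _ → ∑-∈ d (∈-allFin j)
largest {n} d (suc ℓ) ℓ<n with largest d ℓ (<⇒≤ ℓ<n)
... | T , v , refl , T≥ , ≤v with argmax-∉ T d ℓ<n
...   | x , x∉T , max = insert x T , d x , ∣insert∣ x T x∉T , above , below
  where
  above : ∀ i → lookup (insert x T) i ≡ true → d x ≤ d i
  above i i∈ with i Fin.≟ x
  ... | yes refl = ≤-refl
  ... | no  i≢x  = ≤-trans (≤v x x∉T) (T≥ i (trans (sym (lookup∘update′ i≢x T true)) i∈))
  below : ∀ j → lookup (insert x T) j ≡ false → d j ≤ d x
  below j j∉ with j Fin.≟ x
  ... | yes refl = ≤-refl
  ... | no  j≢x  = max j (trans (sym (lookup∘update′ j≢x T true)) j∉)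

2xy≤x²+y² : ∀ x y → 2 * (x * y) ≤ x * x + y * y
2xy≤x²+y² x y with ≤-total x y
... | inj₁ x≤y = subst (λ z → 2 * (x * z) ≤ x * x + z * z) (m+[n∸m]≡n x≤y)
  (≤-trans (m≤m+n _ ((y ∸ x) * (y ∸ x))) (≤-reflexive (id₁ x (y ∸ x))))
  where id₁ : ∀ x o → 2 * (x * (x + o)) + o * o ≡ x * x + (x + o) * (x + o)
        id₁ = solve-∀
... | inj₂ y≤x = subst (λ z → 2 * (z * y) ≤ z * z + y * y) (m+[n∸m]≡n y≤x)
  (≤-trans (m≤m+n _ ((x ∸ y) * (x ∸ y))) (≤-reflexive (id₂ y (x ∸ y))))
  where id₂ : ∀ y o → 2 * ((y + o) * y) + o * o ≡ (y + o) * (y + o) + y * y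
        id₂ = solve-∀

-- Degrees and codegrees in families of k-subsets

module Counting (n k′ : ℕ) where

  k = suc k′

  U : List (Subset n)
  U = kSubsets n k

  Fam : Set
  Fam = Subset n → Bool

  # : Fam → ℕ
  # p = ∑[ A ∈ U ] 𝟙 (p A)

  deg : Fam → Fin n → ℕ
  deg p j = ∑[ A ∈ U ] (𝟙 (p A) * 𝟙 (lookup A j))

  ∑ᶠ : (Fin n → ℕ) → ℕ
  ∑ᶠ = ∑ (allFin n)

  Optimal : Fam → Set
  Optimal p = ∀ q → # q ≡ # p → ∑ᶠ (λ j → deg q j * deg q j) ≤ ∑ᶠ (λ j → deg p j * deg p j)

  -- D and K are the degree of a point and the codegree of a pair in the family of all k-subsets.
  D D₂ K : ℕ
  D  = (n ∸ 1) C k′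
  D₂ = (n ∸ 2) C k′
  K  = D ∸ D₂

  all : Fam
  all _ = true

  avoid : Subset n → Fam
  avoid S A = not (hit S A)

  infixl 7 _⟨_⟩
  infixr 6 _∧ᶠ_

  _∧ᶠ_ : Fam → Fam → Fam
  (p ∧ᶠ q) A = p A ∧ q A

  _⟨_⟩ : Fam → Fin n → Fam
  (p ⟨ i ⟩) A = p A ∧ lookup A i

  ∑-deg-* : ∀ p (w : Fin n → ℕ) →
            ∑ᶠ (λ j → deg p j * w j) ≡ ∑[ A ∈ U ] (𝟙 (p A) * ∑ᶠ (λ j → 𝟙 (lookup A j) * w j))
  ∑-deg-* p w = begin
    ∑ᶠ (λ j → deg p j * w j)
      ≡⟨ ∑-cong (allFin n) (λ j → sym (∑-*ʳ U _ (w j))) ⟩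
    ∑ᶠ (λ j → ∑[ A ∈ U ] (𝟙 (p A) * 𝟙 (lookup A j) * w j))
      ≡⟨ ∑-swap (allFin n) U _ ⟩
    (∑[ A ∈ U ] ∑ᶠ (λ j → 𝟙 (p A) * 𝟙 (lookup A j) * w j))
      ≡⟨ ∑-cong U (λ A → trans (∑-cong (allFin n) λ j → *-assoc (𝟙 (p A)) _ _) (∑-*ˡ (allFin n) (𝟙 (p A)) _)) ⟩
    (∑[ A ∈ U ] (𝟙 (p A) * ∑ᶠ (λ j → 𝟙 (lookup A j) * w j))) ∎
    where open ≡-Reasoning

  ∑-deg : ∀ p → ∑ᶠ (deg p) ≡ # p * k
  ∑-deg p = begin
    ∑ᶠ (deg p)                                            ≡⟨ ∑-swap (allFin n) U _ ⟩
    (∑[ A ∈ U ] ∑ᶠ (λ j → 𝟙 (p A) * 𝟙 (lookup A j)))      ≡⟨ ∑-cong-∈ U (λ A A∈U → trans (∑-*ˡ (allFin n) (𝟙 (p A)) _)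
                                                             (cong (𝟙 (p A) *_) (trans (sym (∣∣-∑ A)) (∈-kSubsets⁻ A∈U)))) ⟩
    (∑[ A ∈ U ] (𝟙 (p A) * k))                            ≡⟨ ∑-*ʳ U _ k ⟩
    # p * k                                               ∎
    where open ≡-Reasoning

  deg-mono : ∀ {p q} → (∀ A → p A ≡ true → q A ≡ true) → ∀ j → deg p j ≤ deg q j
  deg-mono {p} {q} p⊆q j = ∑-mono U λ A → *-monoˡ-≤ (𝟙 (lookup A j)) (le A)
    where
    le : ∀ A → 𝟙 (p A) ≤ 𝟙 (q A)
    le A with p A in eq
    ... | false = z≤n
    ... | true  = ≤-reflexive (cong 𝟙 (sym (p⊆q A eq)))

  deg-split : ∀ p q j → deg p j ≡ deg (p ∧ᶠ q) j + deg (p ∧ᶠ (not ∘ q)) j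
  deg-split p q j = trans (∑-cong U λ A → bool (p A) (q A) (𝟙 (lookup A j))) (∑-+ U _ _)
    where
    bool : ∀ a b x → 𝟙 a * x ≡ 𝟙 (a ∧ b) * x + 𝟙 (a ∧ not b) * x
    bool false b     x = refl
    bool true  false x = refl
    bool true  true  x = sym (+-identityʳ _)

  #-avoid : ∀ S q → ∣ S ∣ + q ≡ n → # (avoid S) ≡ q C k
  #-avoid S q eq = trans (∑-filter (λ A → ∣ A ∣ ≡ᵇ k) (allSubsets n) _) (∑-avoid S q k eq)

  #-all : # all ≡ n C k
  #-all = trans (∑-cong U λ A → cong (𝟙 ∘ not) (sym (hit-⊥ A))) (#-avoid ⊥ n (cong (_+ n) (∣⊥∣≡0 n)))

  #-hit : ∀ S → # (hit S) ≡ sumBinoms n k ∣ S ∣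
  #-hit S = +-cancelʳ-≡ ((n ∸ ∣ S ∣) C k) _ _ (begin
    # (hit S) + (n ∸ ∣ S ∣) C k             ≡⟨ cong (# (hit S) +_) (#-avoid S _ (m+[n∸m]≡n (∣p∣≤n S))) ⟨
    # (hit S) + # (avoid S)                 ≡⟨ ∑-+ U _ _ ⟨
    (∑[ A ∈ U ] (𝟙 (hit S A) + 𝟙 (avoid S A))) ≡⟨ ∑-cong U (λ A → bool (hit S A)) ⟩
    # all                                   ≡⟨ #-all ⟩
    n C k                                   ≡⟨ sumBinoms-C n k′ ∣ S ∣ (∣p∣≤n S) ⟨
    sumBinoms n k ∣ S ∣ + (n ∸ ∣ S ∣) C k   ∎)
    where
    open ≡-Reasoning
    bool : ∀ b → 𝟙 b + 𝟙 (not b) ≡ 1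
    bool false = refl
    bool true  = refl

  -- A set meeting `insert j S` either meets `S`, or avoids `S` and contains `j`; so the degree is
  -- the last summand of `sumBinoms` at `suc ∣ S ∣`.
  deg-avoid : ∀ S j → lookup S j ≡ false → deg (avoid S) j ≡ (n ∸ suc ∣ S ∣) C k′
  deg-avoid S j j∉S = +-cancelˡ-≡ (# (hit S)) _ _ (begin
    # (hit S) + deg (avoid S) j                                        ≡⟨ ∑-+ U _ _ ⟨
    (∑[ A ∈ U ] (𝟙 (hit S A) + 𝟙 (avoid S A) * 𝟙 (lookup A j)))        ≡⟨ ∑-cong U (λ A → trans (bool (hit S A) (lookup A j)) (cong 𝟙 (sym (hit-insert j S A)))) ⟩
    # (hit (insert j S))                                               ≡⟨ #-hit (insert j S) ⟩
    sumBinoms n k ∣ insert j S ∣                                       ≡⟨ cong (sumBinoms n k) (∣insert∣ j S j∉S) ⟩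
    sumBinoms n k ∣ S ∣ + (n ∸ suc ∣ S ∣) C k′                         ≡⟨ cong (_+ (n ∸ suc ∣ S ∣) C k′) (#-hit S) ⟨
    # (hit S) + (n ∸ suc ∣ S ∣) C k′                                   ∎)
    where
    open ≡-Reasoning
    bool : ∀ h a → 𝟙 h + 𝟙 (not h) * 𝟙 a ≡ 𝟙 (a ∨ h)
    bool false false = refl
    bool false true  = refl
    bool true  false = refl
    bool true  true  = refl

  deg-all : ∀ j → deg all j ≡ D
  deg-all j = begin
    deg all j                   ≡⟨ ∑-cong U (λ A → cong (λ b → 𝟙 (not b) * 𝟙 (lookup A j)) (hit-⊥ A)) ⟨
    deg (avoid ⊥) j             ≡⟨ deg-avoid ⊥ j (lookup-replicate j false) ⟩
    (n ∸ suc ∣ ⊥ {n} ∣) C k′    ≡⟨ cong (λ s → (n ∸ suc s) C k′) (∣⊥∣≡0 n) ⟩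
    D                           ∎
    where open ≡-Reasoning

  deg-⟨⟩-self : ∀ p i → deg (p ⟨ i ⟩) i ≡ deg p i
  deg-⟨⟩-self p i = ∑-cong U λ A → bool (p A) (lookup A i)
    where
    bool : ∀ b a → 𝟙 (b ∧ a) * 𝟙 a ≡ 𝟙 b * 𝟙 a
    bool false a     = refl
    bool true  false = refl
    bool true  true  = refl

  -- Sets through `j` contain `i` or avoid it, and `D₂` of them avoid it. So `K` is C(n-2,k-2),
  -- expressed as a difference so that no index `k′ ∸ 1` arises.
  deg-all⟨⟩ : ∀ i j → j ≢ i → deg (all ⟨ i ⟩) j + D₂ ≡ D
  deg-all⟨⟩ i j j≢i = begin
    deg (all ⟨ i ⟩) j + D₂                       ≡⟨ cong (deg (all ⟨ i ⟩) j +_) avoid-i ⟨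
    deg (all ⟨ i ⟩) j + deg (avoid ⁅i⁆) j        ≡⟨ ∑-+ U _ _ ⟨
    (∑[ A ∈ U ] (𝟙 (lookup A i) * 𝟙 (lookup A j) + 𝟙 (avoid ⁅i⁆ A) * 𝟙 (lookup A j)))
      ≡⟨ ∑-cong U (λ A → trans (cong (λ h → 𝟙 (lookup A i) * 𝟙 (lookup A j) + 𝟙 (not h) * 𝟙 (lookup A j))
           (trans (hit-insert i ⊥ A) (cong (lookup A i ∨_) (hit-⊥ A)))) (bool (lookup A i) (lookup A j))) ⟩
    deg all j                                    ≡⟨ deg-all j ⟩
    D                                            ∎
    where
    open ≡-Reasoning
    ⁅i⁆ = insert i ⊥
    avoid-i : deg (avoid ⁅i⁆) j ≡ D₂
    avoid-i = trans (deg-avoid ⁅i⁆ j (trans (lookup∘update′ j≢i ⊥ true) (lookup-replicate j false)))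
      (cong (λ s → (n ∸ suc s) C k′) (trans (∣insert∣ i ⊥ (lookup-replicate i false)) (cong suc (∣⊥∣≡0 n))))
    bool : ∀ a b → 𝟙 a * 𝟙 b + 𝟙 (not (a ∨ false)) * 𝟙 b ≡ 1 * 𝟙 b
    bool false b = refl
    bool true  b = +-identityʳ _

  codeg≡K : ∀ i j → j ≢ i → deg (all ⟨ i ⟩) j ≡ K
  codeg≡K i j j≢i = trans (sym (m+n∸n≡m _ D₂)) (cong (_∸ D₂) (deg-all⟨⟩ i j j≢i))

  codeg≤K : ∀ p i j → j ≢ i → deg (p ⟨ i ⟩) j ≤ K
  codeg≤K p i j j≢i = ≤-trans (deg-mono (λ A → bool (p A) (lookup A i)) j) (≤-reflexive (codeg≡K i j j≢i))
    where
    bool : ∀ a b → a ∧ b ≡ true → b ≡ true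
    bool true b h = h

  δ : Fin n → Fin n → ℕ
  δ i j = 𝟙 (does (j Fin.≟ i))

  ∑-δᶠ : ∀ i (f : Fin n → ℕ) → ∑ᶠ (λ j → δ i j * f j) ≡ f i
  ∑-δᶠ i f = ∑-δ Fin._≟_ f (Unique.allFin⁺ n) (∈-allFin i)

  codeg≤ : ∀ p i j → deg (p ⟨ i ⟩) j ≤ δ i j * deg p j + K
  codeg≤ p i j with j Fin.≟ i
  ... | yes refl = ≤-trans (≤-reflexive (trans (deg-⟨⟩-self p i) (sym (+-identityʳ _)))) (m≤m+n _ K)
  ... | no j≢i   = codeg≤K p i j j≢i

  -- Double counting the pairs (j, A) with i, j ∈ A.
  n*K : Fin n → n * K + D ≡ D * k + K
  n*K i = begin
    n * K + D                                                   ≡⟨ cong₂ _+_ (∑-const n K) (∑-δᶠ i (λ _ → D)) ⟨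
    ∑ᶠ (λ _ → K) + ∑ᶠ (λ j → δ i j * D)                         ≡⟨ ∑-+ (allFin n) _ _ ⟨
    ∑ᶠ (λ j → K + δ i j * D)                                    ≡⟨ ∑-cong (allFin n) ptwise ⟩
    ∑ᶠ (λ j → deg (all ⟨ i ⟩) j + δ i j * K)                    ≡⟨ ∑-+ (allFin n) _ _ ⟩
    ∑ᶠ (deg (all ⟨ i ⟩)) + ∑ᶠ (λ j → δ i j * K)                 ≡⟨ cong₂ _+_ (∑-deg (all ⟨ i ⟩)) (∑-δᶠ i (λ _ → K)) ⟩
    # (all ⟨ i ⟩) * k + K                                       ≡⟨ cong (λ d → d * k + K) (trans (∑-cong U λ A → sym (+-identityʳ _)) (deg-all i)) ⟩
    D * k + K                                                   ∎
    where
    open ≡-Reasoning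
    ptwise : ∀ j → K + δ i j * D ≡ deg (all ⟨ i ⟩) j + δ i j * K
    ptwise j with j Fin.≟ i
    ... | yes refl = trans (+-comm K _) (cong₂ _+_ (trans (+-identityʳ D) (sym (trans (deg-⟨⟩-self all i) (deg-all i)))) (sym (+-identityʳ K)))
    ... | no j≢i   = cong (_+ 0) (sym (codeg≡K i j j≢i))

  -- The source of all smallness: relative to `D`, codegrees are of order k/n. It follows from the
  -- exact count because `K ≤ D`.
  n*K≤ : Fin n → n * K ≤ k * D
  n*K≤ i = +-cancelʳ-≤ D _ _ (≤-trans (≤-reflexive (n*K i)) (+-mono-≤ (≤-reflexive (*-comm D k)) (m∸n≤m D D₂)))

  -- Union bound over the pairs {i, j} with i in `S`: as `j` is outside `S`, each is a genuine pair
  -- and costs at most `K`.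
  deg-hit≤ : ∀ p S j → lookup S j ≡ false → deg (p ∧ᶠ hit S) j ≤ ∣ S ∣ * K
  deg-hit≤ p S j j∉S = begin
    deg (p ∧ᶠ hit S) j
      ≤⟨ ∑-mono U ptwise ⟩
    (∑[ A ∈ U ] ∑ᶠ (λ i → 𝟙 (lookup S i) * (𝟙 ((p ⟨ i ⟩) A) * 𝟙 (lookup A j))))
      ≡⟨ ∑-swap U (allFin n) _ ⟩
    ∑ᶠ (λ i → ∑[ A ∈ U ] (𝟙 (lookup S i) * (𝟙 ((p ⟨ i ⟩) A) * 𝟙 (lookup A j))))
      ≡⟨ ∑-cong (allFin n) (λ i → ∑-*ˡ U (𝟙 (lookup S i)) _) ⟩
    ∑ᶠ (λ i → 𝟙 (lookup S i) * deg (p ⟨ i ⟩) j)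
      ≤⟨ ∑-mono (allFin n) bound ⟩
    ∑ᶠ (λ i → 𝟙 (lookup S i) * K)
      ≡⟨ ∑-*ʳ (allFin n) _ K ⟩
    ∑ᶠ (λ i → 𝟙 (lookup S i)) * K
      ≡⟨ cong (_* K) (∣∣-∑ S) ⟨
    ∣ S ∣ * K ∎
    where
    open ≤-Reasoning
    bound : ∀ i → 𝟙 (lookup S i) * deg (p ⟨ i ⟩) j ≤ 𝟙 (lookup S i) * K
    bound i with lookup S i in i∈S
    ... | false = z≤n
    ... | true  = *-monoʳ-≤ 1 (codeg≤K p i j λ { refl → contradiction (trans (sym i∈S) j∉S) λ () })
    ptwise : ∀ A → 𝟙 ((p ∧ᶠ hit S) A) * 𝟙 (lookup A j) ≤ ∑ᶠ (λ i → 𝟙 (lookup S i) * (𝟙 ((p ⟨ i ⟩) A) * 𝟙 (lookup A j)))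
    ptwise A with hit S A in h | p A in pA
    ... | false | false = z≤n
    ... | false | true  = z≤n
    ... | true  | false = z≤n
    ... | true  | true  with hit⁻ S A h
    ...   | i , i∈S , i∈A = ≤-trans (≤-reflexive (term i∈S i∈A (𝟙 (lookup A j)))) (∑-∈ _ (∈-allFin i))
      where
      term : ∀ {a b} → a ≡ true → b ≡ true → ∀ c → 1 * c ≡ 𝟙 a * (𝟙 b * c)
      term refl refl c = sym (*-identityˡ (1 * c))

  D≤∣S∣K : ∀ S j → lookup S j ≡ false → D ≤ ∣ S ∣ * K + (n ∸ suc ∣ S ∣) C k′
  D≤∣S∣K S j j∉S = ≤-trans (≤-reflexive (trans (sym (deg-all j)) (deg-split all (hit S) j)))
    (+-mono-≤ (deg-hit≤ all S j j∉S) (≤-reflexive (deg-avoid S j j∉S)))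

  -- If A has t points in `S`, then 1[t = 0] + 2t ≤ 1 + t². Summed over the family, Σ t² counts
  -- ordered pairs from `S`: the diagonal returns one copy of the degree sum `W`, which cancels one
  -- of the two on the left, and the rest is at most `∣ S ∣ * (∣ S ∣ * K)`. So the stars of few
  -- points are almost disjoint.
  bonferroni : ∀ p S → # (p ∧ᶠ avoid S) + ∑ᶠ (λ j → deg p j * 𝟙 (lookup S j)) ≤ # p + ∣ S ∣ * (∣ S ∣ * K)
  bonferroni p S = +-cancelʳ-≤ W _ _ (begin
    # (p ∧ᶠ avoid S) + W + W
      ≡⟨ cong (λ w → # (p ∧ᶠ avoid S) + w + w) (∑-deg-* p _) ⟩
    # (p ∧ᶠ avoid S) + (∑[ A ∈ U ] (𝟙 (p A) * t A)) + (∑[ A ∈ U ] (𝟙 (p A) * t A))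
      ≡⟨ trans (∑-+ U _ _) (cong (_+ (∑[ A ∈ U ] (𝟙 (p A) * t A))) (∑-+ U _ _)) ⟨
    (∑[ A ∈ U ] (𝟙 (p A ∧ not (hit S A)) + 𝟙 (p A) * t A + 𝟙 (p A) * t A))
      ≤⟨ ∑-mono U ptwise ⟩
    (∑[ A ∈ U ] (𝟙 (p A) + 𝟙 (p A) * (t A * t A)))
      ≡⟨ ∑-+ U _ _ ⟩
    # p + (∑[ A ∈ U ] (𝟙 (p A) * (t A * t A)))
      ≡⟨ cong (# p +_) squares ⟩
    # p + ∑ᶠ (λ i → 𝟙 (lookup S i) * ∑ᶠ (λ j → deg (p ⟨ i ⟩) j * 𝟙 (lookup S j)))
      ≤⟨ +-monoʳ-≤ (# p) (∑-mono (allFin n) λ i → *-monoʳ-≤ (𝟙 (lookup S i)) (row i)) ⟩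
    # p + ∑ᶠ (λ i → 𝟙 (lookup S i) * (deg p i * 𝟙 (lookup S i) + ∣ S ∣ * K))
      ≡⟨ cong (# p +_) (trans (∑-cong (allFin n) λ i → alg (lookup S i) (deg p i) (∣ S ∣ * K)) (∑-+ (allFin n) _ _)) ⟩
    # p + (∑ᶠ (λ i → 𝟙 (lookup S i) * (∣ S ∣ * K)) + W)
      ≡⟨ cong (λ z → # p + (z + W)) (trans (∑-*ʳ (allFin n) _ (∣ S ∣ * K)) (cong (_* (∣ S ∣ * K)) (sym (∣∣-∑ S)))) ⟩
    # p + (∣ S ∣ * (∣ S ∣ * K) + W)
      ≡⟨ +-assoc (# p) _ W ⟨
    # p + ∣ S ∣ * (∣ S ∣ * K) + W ∎)
    where
    open ≤-Reasoning
    W = ∑ᶠ (λ j → deg p j * 𝟙 (lookup S j))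
    t : Subset n → ℕ
    t A = ∑ᶠ (λ j → 𝟙 (lookup A j) * 𝟙 (lookup S j))

    t≡0 : ∀ A → hit S A ≡ false → t A ≡ 0
    t≡0 A h = trans (∑-cong (allFin n) zeros) (∑-0 (allFin n))
      where
      zeros : ∀ j → 𝟙 (lookup A j) * 𝟙 (lookup S j) ≡ 0
      zeros j with lookup S j in j∈S
      ... | false = *-zeroʳ (𝟙 (lookup A j))
      ... | true  = cong (λ b → 𝟙 b * 1) (hit-∉ S A j h j∈S)

    2t≤ : ∀ t → 1 * t + 1 * t ≤ 1 + 1 * (t * t)
    2t≤ t = ≤-trans (≤-reflexive (lhs t)) (≤-trans (2xy≤x²+y² 1 t) (≤-reflexive (rhs t)))
      where
      lhs : ∀ t → 1 * t + 1 * t ≡ 2 * (1 * t)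
      lhs = solve-∀
      rhs : ∀ t → 1 * 1 + t * t ≡ 1 + 1 * (t * t)
      rhs = solve-∀

    ptwise : ∀ A → 𝟙 (p A ∧ not (hit S A)) + 𝟙 (p A) * t A + 𝟙 (p A) * t A ≤ 𝟙 (p A) + 𝟙 (p A) * (t A * t A)
    ptwise A with p A
    ... | false = z≤n
    ... | true  with hit S A in h
    ...   | true  = 2t≤ (t A)
    ...   | false rewrite t≡0 A h = ≤-refl

    squares : ∑[ A ∈ U ] (𝟙 (p A) * (t A * t A)) ≡ ∑ᶠ (λ i → 𝟙 (lookup S i) * ∑ᶠ (λ j → deg (p ⟨ i ⟩) j * 𝟙 (lookup S j)))
    squares = trans (∑-cong U expand) (trans (∑-swap U (allFin n) _) (∑-cong (allFin n) λ i →
      trans (∑-*ˡ U (𝟙 (lookup S i)) _) (cong (𝟙 (lookup S i) *_) (sym (∑-deg-* (p ⟨ i ⟩) _)))))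
      where
      alg′ : ∀ a b c t → a * (b * c * t) ≡ c * (a * b * t)
      alg′ = solve-∀
      expand : ∀ A → 𝟙 (p A) * (t A * t A) ≡ ∑ᶠ (λ i → 𝟙 (lookup S i) * (𝟙 ((p ⟨ i ⟩) A) * t A))
      expand A = trans (cong (𝟙 (p A) *_) (sym (∑-*ʳ (allFin n) _ (t A)))) (trans (sym (∑-*ˡ (allFin n) (𝟙 (p A)) _))
        (∑-cong (allFin n) λ i → trans (alg′ (𝟙 (p A)) (𝟙 (lookup A i)) (𝟙 (lookup S i)) (t A))
          (cong (λ z → 𝟙 (lookup S i) * (z * t A)) (sym (𝟙-∧ (p A) (lookup A i))))))

    row : ∀ i → ∑ᶠ (λ j → deg (p ⟨ i ⟩) j * 𝟙 (lookup S j)) ≤ deg p i * 𝟙 (lookup S i) + ∣ S ∣ * K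
    row i = begin
      ∑ᶠ (λ j → deg (p ⟨ i ⟩) j * 𝟙 (lookup S j))
        ≤⟨ ∑-mono (allFin n) (λ j → *-monoˡ-≤ (𝟙 (lookup S j)) (codeg≤ p i j)) ⟩
      ∑ᶠ (λ j → (δ i j * deg p j + K) * 𝟙 (lookup S j))
        ≡⟨ trans (∑-cong (allFin n) λ j → alg″ (δ i j) (deg p j) K (𝟙 (lookup S j))) (∑-+ (allFin n) _ _) ⟩
      ∑ᶠ (λ j → δ i j * (deg p j * 𝟙 (lookup S j))) + ∑ᶠ (λ j → 𝟙 (lookup S j) * K)
        ≡⟨ cong₂ _+_ (∑-δᶠ i _) (trans (∑-*ʳ (allFin n) _ K) (cong (_* K) (sym (∣∣-∑ S)))) ⟩
      deg p i * 𝟙 (lookup S i) + ∣ S ∣ * K ∎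
      where
      alg″ : ∀ d e k s → (d * e + k) * s ≡ d * (e * s) + s * k
      alg″ = solve-∀

    alg : ∀ b d z → 𝟙 b * (d * 𝟙 b + z) ≡ 𝟙 b * z + d * 𝟙 b
    alg false d z = sym (*-zeroʳ d)
    alg true  d z = alg‴ d z
      where
      alg‴ : ∀ d z → 1 * (d * 1 + z) ≡ 1 * z + d * 1
      alg‴ = solve-∀

-- Arithmetic behind the concentration of F′ on one point

small-β-impossible : ∀ {β m} → 100 * β ≤ m → 0 < m → ¬ (m * m ≤ β * (48 * m + 256 * β))
small-β-impossible {β} {m@(suc _)} β≤ _ h = contradiction
  (*-cancelʳ-≤ 100 51 m (*-cancelʳ-≤ (100 * m) (51 * m) m (begin
    100 * m * m                       ≡⟨ *-assoc 100 m m ⟩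
    100 * (m * m)                     ≤⟨ *-monoʳ-≤ 100 h ⟩
    100 * (β * (48 * m + 256 * β))    ≡⟨ *-assoc 100 β _ ⟨
    -- 256 is rounded up to 300 so that 100β ≤ m bounds the last term by 3m; then 48 + 3 < 100 gives
    -- the contradiction.
    100 * β * (48 * m + 256 * β)      ≤⟨ *-mono-≤ β≤ (+-monoʳ-≤ (48 * m) (*-monoˡ-≤ β (≤ᵇ⇒≤ 256 300 _))) ⟩
    m * (48 * m + 300 * β)            ≡⟨ cong (λ z → m * (48 * m + z)) (*-assoc 3 100 β) ⟩
    m * (48 * m + 3 * (100 * β))      ≤⟨ *-monoʳ-≤ m (+-monoʳ-≤ (48 * m) (*-monoʳ-≤ 3 β≤)) ⟩
    m * (48 * m + 3 * m)              ≡⟨ cong (m *_) (sym (*-distribʳ-+ m 48 3)) ⟩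
    m * (51 * m)                      ≡⟨ *-comm m _ ⟩
    51 * m * m                        ∎)))
  (<⇒≱ (≤ᵇ⇒≤ 52 100 _))
  where open ≤-Reasoning

-- To be read with `T` a set of largest degrees in F′, all others being at most v: `S` is the degree
-- sum over `T`, `P` the number of members avoiding `T`, `W = k * v` a bound for the degree sum of
-- such a member, and `Q` the sum of squared degrees. Up to errors in `β`, `Q` is at most max(u, W)
-- times `m + e`. If 2u is too small, `u` as the maximum contradicts `hA`; `W` cannot be the maximum
-- because it is at most about a quarter of both `D` and `m + e`.
large-degree : ∀ {m e u D β S P W Q} →
  m * m + (D + u) * e ≤ 2 * (β * e) + Q →
  Q ≤ u * S + 4 * β * (m + e) + P * W →
  P + S ≤ m + e + 16 * β →
  4 * W ≤ D + 16 * β →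
  4 * W ≤ m + e + 16 * β →
  100 * β ≤ m → m ≤ D → 0 < m →
  m + e + 6 * β < 2 * u
large-degree {m} {e} {u} {D} {β} {S} {P} {W} {Q} hA hB hC hD hE hF hG hm = ≰⇒> (impossible (≤-total W u))
  where
  open ≤-Reasoning
  cβ≤m : ∀ c → c ≤ 100 → c * β ≤ m
  cβ≤m c c≤100 = ≤-trans (*-monoˡ-≤ β c≤100) hF

  total : ∀ V → u ≤ V → W ≤ V → m * m + (D + u) * e ≤ 2 * (β * e) + (4 * β * (m + e) + V * (m + e + 16 * β))
  total V u≤V W≤V = begin
    m * m + (D + u) * e                                    ≤⟨ hA ⟩
    2 * (β * e) + Q                                        ≤⟨ +-monoʳ-≤ (2 * (β * e)) hB ⟩
    2 * (β * e) + (u * S + 4 * β * (m + e) + P * W)        ≤⟨ +-monoʳ-≤ (2 * (β * e)) (+-mono-≤ (+-monoˡ-≤ _ (*-monoˡ-≤ S u≤V)) (*-monoʳ-≤ P W≤V)) ⟩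
    2 * (β * e) + (V * S + 4 * β * (m + e) + P * V)        ≡⟨ i V S P (4 * β * (m + e)) (2 * (β * e)) ⟩
    2 * (β * e) + (4 * β * (m + e) + V * (P + S))          ≤⟨ +-monoʳ-≤ (2 * (β * e)) (+-monoʳ-≤ (4 * β * (m + e)) (*-monoʳ-≤ V hC)) ⟩
    2 * (β * e) + (4 * β * (m + e) + V * (m + e + 16 * β)) ∎
    where
    i : ∀ v s p a b → b + (v * s + a + p * v) ≡ b + (a + v * (p + s))
    i = solve-∀

  impossible : W ≤ u ⊎ u ≤ W → ¬ (2 * u ≤ m + e + 6 * β)
  -- With V = u the terms `u * e` cancel. After doubling, the bound on 2u consumes one of the two
  -- copies of `m * m`, and its multiples of `e` are covered by `2 * (D * e)`.
  impossible (inj₁ W≤u) 2u≤ = small-β-impossible {β} hF hm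
    (≤-trans (+-cancelʳ-≤ (m * m + 2 * (D * e)) _ _ (begin
      m * m + (m * m + 2 * (D * e))                                 ≡⟨ i₁ m D e ⟩
      2 * (m * m + D * e)                                           ≤⟨ *-monoʳ-≤ 2 cancelled ⟩
      2 * (6 * (β * e) + 4 * (β * m) + u * (m + 16 * β))            ≡⟨ i₂ β e m u ⟩
      12 * (β * e) + 8 * (β * m) + 2 * u * (m + 16 * β)             ≤⟨ +-monoʳ-≤ (12 * (β * e) + 8 * (β * m)) (*-monoˡ-≤ (m + 16 * β) 2u≤) ⟩
      12 * (β * e) + 8 * (β * m) + (m + e + 6 * β) * (m + 16 * β)   ≡⟨ i₃ β e m ⟩
      β * (30 * m + 96 * β) + (m * m + (m + 28 * β) * e)            ≤⟨ +-monoʳ-≤ (β * (30 * m + 96 * β)) (+-monoʳ-≤ (m * m) (*-monoˡ-≤ e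
                                                                        (+-mono-≤ hG (≤-trans (cβ≤m 28 (≤ᵇ⇒≤ 28 100 _)) hG)))) ⟩
      β * (30 * m + 96 * β) + (m * m + (D + D) * e)                 ≡⟨ i₄ (β * (30 * m + 96 * β)) m D e ⟩
      β * (30 * m + 96 * β) + (m * m + 2 * (D * e))                 ∎))
      (*-monoʳ-≤ β (+-mono-≤ (*-monoˡ-≤ m (≤ᵇ⇒≤ 30 48 _)) (*-monoˡ-≤ β (≤ᵇ⇒≤ 96 256 _)))))
    where
    i₀ : ∀ m D u e → m * m + D * e + u * e ≡ m * m + (D + u) * e
    i₀ = solve-∀
    i₀′ : ∀ m u e β → 2 * (β * e) + (4 * β * (m + e) + u * (m + e + 16 * β)) ≡ 6 * (β * e) + 4 * (β * m) + u * (m + 16 * β) + u * e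
    i₀′ = solve-∀
    i₁ : ∀ m D e → m * m + (m * m + 2 * (D * e)) ≡ 2 * (m * m + D * e)
    i₁ = solve-∀
    i₂ : ∀ β e m u → 2 * (6 * (β * e) + 4 * (β * m) + u * (m + 16 * β)) ≡ 12 * (β * e) + 8 * (β * m) + 2 * u * (m + 16 * β)
    i₂ = solve-∀
    i₃ : ∀ β e m → 12 * (β * e) + 8 * (β * m) + (m + e + 6 * β) * (m + 16 * β) ≡ β * (30 * m + 96 * β) + (m * m + (m + 28 * β) * e)
    i₃ = solve-∀
    i₄ : ∀ a m D e → a + (m * m + (D + D) * e) ≡ a + (m * m + 2 * (D * e))
    i₄ = solve-∀
    cancelled : m * m + D * e ≤ 6 * (β * e) + 4 * (β * m) + u * (m + 16 * β)
    cancelled = +-cancelʳ-≤ (u * e) _ _ (begin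
      m * m + D * e + u * e                                        ≡⟨ i₀ m D u e ⟩
      m * m + (D + u) * e                                          ≤⟨ total u ≤-refl W≤u ⟩
      2 * (β * e) + (4 * β * (m + e) + u * (m + e + 16 * β))       ≡⟨ i₀′ m u e β ⟩
      6 * (β * e) + 4 * (β * m) + u * (m + 16 * β) + u * e         ∎)
  -- With V = W and everything scaled by 4, `4 * W` is bounded by `hE` where it multiplies
  -- `m + 16 * β` and by `hD` where it multiplies `e`. This consumes one copy of `m * m` and at most
  -- `4 * (D * e)`.
  impossible (inj₂ u≤W) _ = small-β-impossible {β} hF hm (≤-trans (m≤m+n (m * m) (2 * (m * m)))
    (+-cancelʳ-≤ (m * m + 4 * (D * e)) _ _ (begin
      m * m + 2 * (m * m) + (m * m + 4 * (D * e))                   ≡⟨ i₁ m D e ⟩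
      4 * (m * m + D * e)                                           ≤⟨ *-monoʳ-≤ 4 (≤-trans (+-monoʳ-≤ (m * m) (*-monoˡ-≤ e (m≤m+n D u))) (total W u≤W ≤-refl)) ⟩
      4 * (2 * (β * e) + (4 * β * (m + e) + W * (m + e + 16 * β)))  ≡⟨ i₂ β e m W ⟩
      24 * (β * e) + 16 * (β * m) + 4 * W * (m + 16 * β) + 4 * W * e
        ≤⟨ +-mono-≤ (+-monoʳ-≤ (24 * (β * e) + 16 * (β * m)) (*-monoˡ-≤ (m + 16 * β) hE)) (*-monoˡ-≤ e hD) ⟩
      24 * (β * e) + 16 * (β * m) + (m + e + 16 * β) * (m + 16 * β) + (D + 16 * β) * e ≡⟨ i₃ β e m D ⟩
      β * (48 * m + 256 * β) + (m * m + (D + (m + 56 * β)) * e)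
        ≤⟨ +-monoʳ-≤ (β * (48 * m + 256 * β)) (+-monoʳ-≤ (m * m) (*-monoˡ-≤ e
             (+-monoʳ-≤ D (+-mono-≤ hG (≤-trans (≤-trans (cβ≤m 56 (≤ᵇ⇒≤ 56 100 _)) hG) (m≤m+n D D)))))) ⟩
      β * (48 * m + 256 * β) + (m * m + (D + (D + (D + D))) * e)      ≡⟨ i₄ (β * (48 * m + 256 * β)) m D e ⟩
      β * (48 * m + 256 * β) + (m * m + 4 * (D * e))                ∎)))
    where
    i₁ : ∀ m D e → m * m + 2 * (m * m) + (m * m + 4 * (D * e)) ≡ 4 * (m * m + D * e)
    i₁ = solve-∀
    i₂ : ∀ β e m W → 4 * (2 * (β * e) + (4 * β * (m + e) + W * (m + e + 16 * β))) ≡ 24 * (β * e) + 16 * (β * m) + 4 * W * (m + 16 * β) + 4 * W * e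
    i₂ = solve-∀
    i₃ : ∀ β e m D → 24 * (β * e) + 16 * (β * m) + (m + e + 16 * β) * (m + 16 * β) + (D + 16 * β) * e ≡ β * (48 * m + 256 * β) + (m * m + (D + (m + 56 * β)) * e)
    i₃ = solve-∀
    i₄ : ∀ a m D e → a + (m * m + (D + (D + (D + D))) * e) ≡ a + (m * m + 4 * (D * e))
    i₄ = solve-∀

-- The square lies above its tangent at `d`: d′² ≥ d² + 2d(d′ - d), where d′ - d = b - a is written
-- without subtraction.
swap-square : ∀ {d d′ a b} → d′ + a ≡ d + b → d * d + 2 * (d * b) ≤ d′ * d′ + 2 * (d * a)
swap-square {d} {d′} {a} {b} eq = +-cancelʳ-≤ (d * d) _ _ (begin
  d * d + 2 * (d * b) + d * d      ≡⟨ i₁ d b ⟩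
  2 * (d * (d + b))                ≡⟨ cong (λ z → 2 * (d * z)) eq ⟨
  2 * (d * (d′ + a))               ≡⟨ i₂ d d′ a ⟩
  2 * (d * d′) + 2 * (d * a)       ≤⟨ +-monoˡ-≤ _ (2xy≤x²+y² d d′) ⟩
  d * d + d′ * d′ + 2 * (d * a)    ≡⟨ i₃ d d′ a ⟩
  d′ * d′ + 2 * (d * a) + d * d    ∎)
  where
  open ≤-Reasoning
  i₁ : ∀ d b → d * d + 2 * (d * b) + d * d ≡ 2 * (d * (d + b))
  i₁ = solve-∀
  i₂ : ∀ d d′ a → 2 * (d * (d′ + a)) ≡ 2 * (d * d′) + 2 * (d * a)
  i₂ = solve-∀
  i₃ : ∀ d d′ a → d * d + d′ * d′ + 2 * (d * a) ≡ d′ * d′ + 2 * (d * a) + d * d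
  i₃ = solve-∀

-- β = k² s² K is the unit for the error terms, ℓ = 4 k s the number of degrees treated individually.
record Scale (n k s m K : ℕ) : Set where
  field
    β ℓ         : ℕ
    100β≤m      : 100 * β ≤ m
    sKk≤β       : s * K * k ≤ β
    ℓ≤n         : ℓ ≤ n
    4ks≤ℓ       : 4 * (k * s) ≤ ℓ
    ℓKk≤4β      : ℓ * K * k ≤ 4 * β
    ℓℓK≤16β     : ℓ * (ℓ * K) ≤ 16 * β
    [k+1]²K≤5β  : suc k * (suc k * K) ≤ 5 * β

-- Structure of an extremal family

module Extremal (n k′ : ℕ) (p : Subset n → Bool) (optimal : Counting.Optimal n k′ p) where

  open Counting n k′

  weight : Subset n → ℕ
  weight A = ∑ᶠ (λ j → deg p j * 𝟙 (lookup A j))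

  #≤∑-deg : ∀ q S → (∀ A → q A ≡ true → hit S A ≡ true) → # q ≤ ∑ᶠ (λ j → deg q j * 𝟙 (lookup S j))
  #≤∑-deg q S q⊆S = ≤-trans (∑-mono U ptwise) (≤-reflexive (sym (∑-deg-* q _)))
    where
    ptwise : ∀ A → 𝟙 (q A) ≤ 𝟙 (q A) * ∑ᶠ (λ j → 𝟙 (lookup A j) * 𝟙 (lookup S j))
    ptwise A with q A in qA
    ... | false = z≤n
    ... | true with hit⁻ S A (q⊆S A qA)
    ...   | j , j∈S , j∈A = ≤-trans (≤-trans (≤-reflexive (sym (cong₂ (λ a b → 𝟙 a * 𝟙 b) j∈A j∈S))) (∑-∈ _ (∈-allFin j)))
                                  (≤-reflexive (sym (*-identityˡ _)))

  -- Replacing A by B changes the sum of squared degrees by at least 2 (weight B - weight A).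
  exchange : ∀ {A B} → A ∈ₗ U → B ∈ₗ U → p A ≡ true → p B ≡ false → weight B ≤ weight A
  exchange {A} {B} A∈U B∈U pA pB = *-cancelˡ-≤ 2 (+-cancelˡ-≤ (∑ᶠ (λ j → deg p j * deg p j)) _ _ (begin
    ∑ᶠ (λ j → deg p j * deg p j) + 2 * weight B
      ≡⟨ trans (∑-+ (allFin n) _ _) (cong (∑ᶠ (λ j → deg p j * deg p j) +_) (∑-*ˡ (allFin n) 2 _)) ⟨
    ∑ᶠ (λ j → deg p j * deg p j + 2 * (deg p j * 𝟙 (lookup B j)))
      ≤⟨ ∑-mono (allFin n) (λ j → swap-square {deg p j} {deg q j} (trans (cong (deg q j +_) (sym (*-identityˡ _)))
           (trans (moved (λ Z → 𝟙 (lookup Z j))) (cong (deg p j +_) (*-identityˡ _))))) ⟩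
    ∑ᶠ (λ j → deg q j * deg q j + 2 * (deg p j * 𝟙 (lookup A j)))
      ≡⟨ trans (∑-+ (allFin n) _ _) (cong (∑ᶠ (λ j → deg q j * deg q j) +_) (∑-*ˡ (allFin n) 2 _)) ⟩
    ∑ᶠ (λ j → deg q j * deg q j) + 2 * weight A
      ≤⟨ +-monoˡ-≤ _ (optimal q #q) ⟩
    ∑ᶠ (λ j → deg p j * deg p j) + 2 * weight A ∎))
    where
    open ≤-Reasoning
    q : Fam
    q Z = if does (Z ≟ₛ A) then false else (does (Z ≟ₛ B) ∨ p Z)

    indicator : ∀ Z → 𝟙 (q Z) + 𝟙 (does (Z ≟ₛ A)) ≡ 𝟙 (p Z) + 𝟙 (does (Z ≟ₛ B))
    indicator Z with Z ≟ₛ A | Z ≟ₛ B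
    ... | yes refl | yes refl = contradiction (trans (sym pA) pB) λ ()
    ... | yes refl | no _ rewrite pA = refl
    ... | no _ | yes refl rewrite pB = refl
    ... | no _ | no _ = refl

    moved : ∀ (w : Subset n → ℕ) → (∑[ Z ∈ U ] (𝟙 (q Z) * w Z)) + 1 * w A ≡ (∑[ Z ∈ U ] (𝟙 (p Z) * w Z)) + 1 * w B
    moved w = begin-equality
      (∑[ Z ∈ U ] (𝟙 (q Z) * w Z)) + 1 * w A
        ≡⟨ cong ((∑[ Z ∈ U ] (𝟙 (q Z) * w Z)) +_) (trans (*-identityˡ _) (sym (∑-δ _≟ₛ_ w (kSubsets-unique n k) A∈U))) ⟩
      (∑[ Z ∈ U ] (𝟙 (q Z) * w Z)) + (∑[ Z ∈ U ] (𝟙 (does (Z ≟ₛ A)) * w Z))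
        ≡⟨ ∑-+ U _ _ ⟨
      (∑[ Z ∈ U ] (𝟙 (q Z) * w Z + 𝟙 (does (Z ≟ₛ A)) * w Z))
        ≡⟨ ∑-cong U (λ Z → trans (sym (*-distribʳ-+ (w Z) (𝟙 (q Z)) _)) (trans (cong (_* w Z) (indicator Z)) (*-distribʳ-+ (w Z) (𝟙 (p Z)) _))) ⟩
      (∑[ Z ∈ U ] (𝟙 (p Z) * w Z + 𝟙 (does (Z ≟ₛ B)) * w Z))
        ≡⟨ ∑-+ U _ _ ⟩
      (∑[ Z ∈ U ] (𝟙 (p Z) * w Z)) + (∑[ Z ∈ U ] (𝟙 (does (Z ≟ₛ B)) * w Z))
        ≡⟨ cong ((∑[ Z ∈ U ] (𝟙 (p Z) * w Z)) +_) (trans (*-identityˡ _) (sym (∑-δ _≟ₛ_ w (kSubsets-unique n k) B∈U))) ⟨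
      (∑[ Z ∈ U ] (𝟙 (p Z) * w Z)) + 1 * w B ∎

    #q : # q ≡ # p
    #q = +-cancelʳ-≡ 1 (# q) (# p) (begin-equality
      # q + 1                                 ≡⟨ cong (_+ 1) (∑-cong U λ Z → sym (*-identityʳ (𝟙 (q Z)))) ⟩
      (∑[ Z ∈ U ] (𝟙 (q Z) * 1)) + 1          ≡⟨ moved (λ _ → 1) ⟩
      (∑[ Z ∈ U ] (𝟙 (p Z) * 1)) + 1          ≡⟨ cong (_+ 1) (∑-cong U λ Z → *-identityʳ (𝟙 (p Z))) ⟩
      # p + 1                                 ∎)

  module Structure
    (R : Subset n) (x : Fin n) (m : ℕ)
    (#p : # p ≡ # (hit R) + m)
    (x∉R : lookup R x ≡ false)
    (R-top : ∀ i j → lookup R i ≡ true → lookup R j ≡ false → deg p j ≤ deg p i)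
    (x-top : ∀ j → lookup R j ≡ false → deg (p ∧ᶠ avoid R) j ≤ deg (p ∧ᶠ avoid R) x)
    where

    f H : Fam
    f = p ∧ᶠ avoid R
    H = hit R ∧ᶠ (not ∘ p)

    e u c E r s : ℕ
    e = # H
    u = deg f x
    r = ∣ R ∣
    s = suc r
    E = (n ∸ s) C k′
    c = deg (hit R) x

    #f : # f ≡ m + e
    #f = +-cancelˡ-≡ (# (hit R)) _ _ (begin
      # (hit R) + # f          ≡⟨ ∑-+ U _ _ ⟨
      (∑[ A ∈ U ] (𝟙 (hit R A) + 𝟙 (f A)))  ≡⟨ ∑-cong U (λ A → bool (p A) (hit R A)) ⟩
      (∑[ A ∈ U ] (𝟙 (p A) + 𝟙 (H A)))      ≡⟨ ∑-+ U _ _ ⟩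
      # p + e                  ≡⟨ cong (_+ e) #p ⟩
      # (hit R) + m + e        ≡⟨ +-assoc (# (hit R)) m e ⟩
      # (hit R) + (m + e)      ∎)
      where
      open ≡-Reasoning
      bool : ∀ a h → 𝟙 h + 𝟙 (a ∧ not h) ≡ 𝟙 a + 𝟙 (h ∧ not a)
      bool false false = refl
      bool false true  = refl
      bool true  false = refl
      bool true  true  = refl

    -- The union of F with all sets meeting `R`, decomposed in two ways: F and the missing sets, or
    -- the sets meeting `R` and F′.
    deg-p : ∀ j → deg p j + deg H j ≡ deg (hit R) j + deg f j
    deg-p j = trans (sym (∑-+ U _ _)) (trans (∑-cong U λ A → bool (p A) (hit R A) (𝟙 (lookup A j))) (∑-+ U _ _))
      where
      bool : ∀ a h y → 𝟙 a * y + 𝟙 (h ∧ not a) * y ≡ 𝟙 h * y + 𝟙 (a ∧ not h) * y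
      bool false false y = refl
      bool false true  y = sym (+-identityʳ _)
      bool true  false y = +-comm (1 * y) 0
      bool true  true  y = refl

    deg-∈R : ∀ {g} → (∀ A → g A ≡ true → avoid R A ≡ true) → ∀ j → lookup R j ≡ true → deg g j ≡ 0
    deg-∈R {g} g⊆ j j∈R = trans (∑-cong U zeros) (∑-0 U)
      where
      zeros : ∀ A → 𝟙 (g A) * 𝟙 (lookup A j) ≡ 0
      zeros A with g A in gA | lookup A j in j∈A
      ... | false | _     = refl
      ... | true  | false = refl
      ... | true  | true  = contradiction (trans (sym (g⊆ A gA)) (cong not (hit⁺ R A j j∈R j∈A))) λ ()

    deg-hit : ∀ j → deg (hit R) j + deg (avoid R) j ≡ D
    deg-hit j = trans (sym (deg-split all (hit R) j)) (deg-all j)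

    deg-hit-∈ : ∀ j → lookup R j ≡ true → deg (hit R) j ≡ D
    deg-hit-∈ j j∈R = trans (sym (+-identityʳ _)) (trans (cong (deg (hit R) j +_) (sym (deg-∈R (λ _ h → h) j j∈R))) (deg-hit j))

    deg-hit+E : ∀ j → lookup R j ≡ false → deg (hit R) j + E ≡ D
    deg-hit+E j j∉R = trans (cong (deg (hit R) j +_) (sym (deg-avoid R j j∉R))) (deg-hit j)

    deg-hit-∉ : ∀ j → lookup R j ≡ false → deg (hit R) j ≡ c
    deg-hit-∉ j j∉R = +-cancelʳ-≡ E _ _ (trans (deg-hit+E j j∉R) (sym (deg-hit+E x x∉R)))

    c≤ : c ≤ r * K
    c≤ = deg-hit≤ all R x x∉R

    E≤D : E ≤ D
    E≤D = ≤-trans (m≤n+m E c) (≤-reflexive (deg-hit+E x x∉R))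

    f⊆ : ∀ A → f A ≡ true → avoid R A ≡ true
    f⊆ A fA with p A
    ... | true = fA

    f⊆p : ∀ A → f A ≡ true → p A ≡ true
    f⊆p A fA with p A
    ... | true = refl

    f≤p : ∀ j → deg f j ≤ deg p j
    f≤p = deg-mono f⊆p

    f≤u : ∀ j → deg f j ≤ u
    f≤u j with lookup R j in eq
    ... | false = x-top j eq
    ... | true  = ≤-trans (≤-reflexive (deg-∈R f⊆ j eq)) z≤n

    u≤R : ∀ i → lookup R i ≡ true → u ≤ deg p i
    u≤R i i∈R = ≤-trans (f≤p x) (R-top i x i∈R x∉R)

    -- Comparison with the family hit R ∪ g.
    compare : ∀ g → (∀ A → g A ≡ true → avoid R A ≡ true) → # g ≡ m →
      ∑ᶠ (λ j → deg g j * deg g j) + (D + u) * e ≤ 2 * (c * (k * e)) + ∑ᶠ (λ j → deg f j * deg f j)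
    compare g g⊆ #g = +-cancelˡ-≤ (∑h² + 2 * c * (m * k)) _ _ (begin
      ∑h² + 2 * c * (m * k) + (∑² g + (D + u) * e)                 ≡⟨ +-assoc (∑h² + 2 * c * (m * k)) (∑² g) _ ⟨
      ∑h² + 2 * c * (m * k) + ∑² g + (D + u) * e                   ≡⟨ cong (_+ (D + u) * e) (trans (cong (λ z → ∑h² + 2 * c * (z * k) + ∑² g) (sym #g)) (sym (expand g g⊆))) ⟩
      ∑ᶠ (λ j → (h j + deg g j) * (h j + deg g j)) + (D + u) * e   ≡⟨ cong (_+ (D + u) * e) (∑-cong (allFin n) λ j → cong (λ z → z * z) (sym (deg-q j))) ⟩
      -- Each missing set meets `R`, so `e` is at most the sum over `R` of the degrees in `H`; this
      -- distributes `(D + u) * e` over the points of `R`.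
      ∑² q + (D + u) * e                                           ≤⟨ +-mono-≤ (optimal q #q) (*-monoʳ-≤ (D + u) (#≤∑-deg H R H⊆)) ⟩
      ∑² p + (D + u) * ∑ᶠ (λ j → deg H j * 𝟙 (lookup R j))         ≡⟨ trans (∑-+ (allFin n) _ _) (cong (∑² p +_) (∑-*ˡ (allFin n) (D + u) _)) ⟨
      ∑ᶠ (λ j → deg p j * deg p j + (D + u) * (deg H j * 𝟙 (lookup R j)))  ≤⟨ ∑-mono (allFin n) ptwise ⟩
      ∑ᶠ (λ j → (h j + deg f j) * (h j + deg f j))                 ≡⟨ expand f f⊆ ⟩
      ∑h² + 2 * c * (# f * k) + ∑² f                               ≡⟨ cong (λ z → ∑h² + 2 * c * (z * k) + ∑² f) #f ⟩
      ∑h² + 2 * c * ((m + e) * k) + ∑² f                           ≡⟨ i ∑h² c m k e (∑² f) ⟩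
      ∑h² + 2 * c * (m * k) + (2 * (c * (k * e)) + ∑² f)           ∎)
      where
      open ≤-Reasoning
      ∑² : Fam → ℕ
      ∑² q = ∑ᶠ (λ j → deg q j * deg q j)
      h = deg (hit R)
      ∑h² = ∑² (hit R)
      i : ∀ a c m k e b → a + 2 * c * ((m + e) * k) + b ≡ a + 2 * c * (m * k) + (2 * (c * (k * e)) + b)
      i = solve-∀

      q : Fam
      q A = hit R A ∨ g A

      q-bool : ∀ A → 𝟙 (q A) ≡ 𝟙 (hit R A) + 𝟙 (g A)
      q-bool A with hit R A in hA | g A in gA
      ... | false | _     = refl
      ... | true  | false = refl
      ... | true  | true  = contradiction (trans (sym (g⊆ A gA)) (cong not hA)) λ ()

      #q : # q ≡ # p
      #q = trans (∑-cong U q-bool) (trans (∑-+ U _ _) (trans (cong (# (hit R) +_) #g) (sym #p)))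

      deg-q : ∀ j → deg q j ≡ h j + deg g j
      deg-q j = trans (∑-cong U λ A → trans (cong (_* 𝟙 (lookup A j)) (q-bool A)) (*-distribʳ-+ (𝟙 (lookup A j)) (𝟙 (hit R A)) _)) (∑-+ U _ _)

      H⊆ : ∀ A → H A ≡ true → hit R A ≡ true
      H⊆ A HA with hit R A
      ... | true = refl

      -- The right side squares the degree after the missing sets are restored. Off `R`, restoring
      -- does not lower a degree; on `R` the restored degree is exactly `D`, so the gain is
      -- explicit.
      ptwise : ∀ j → deg p j * deg p j + (D + u) * (deg H j * 𝟙 (lookup R j)) ≤ (h j + deg f j) * (h j + deg f j)
      ptwise j with lookup R j in eq
      ... | false = begin
        deg p j * deg p j + (D + u) * (deg H j * 0)   ≡⟨ trans (cong (λ z → deg p j * deg p j + (D + u) * z) (*-zeroʳ (deg H j))) (trans (cong (deg p j * deg p j +_) (*-zeroʳ (D + u))) (+-identityʳ _)) ⟩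
        deg p j * deg p j                             ≤⟨ *-mono-≤ le le ⟩
        (h j + deg f j) * (h j + deg f j)             ∎
        where
        le : deg p j ≤ h j + deg f j
        le = ≤-trans (m≤m+n _ (deg H j)) (≤-reflexive (deg-p j))
      ... | true = begin
        d * d + (D + u) * (η * 1)                     ≤⟨ +-monoʳ-≤ (d * d) (*-monoˡ-≤ (η * 1) (+-mono-≤ (≤-reflexive (sym d+η)) (u≤R j eq))) ⟩
        d * d + (d + η + d) * (η * 1)                 ≡⟨ square d η ⟩
        (d + η) * (d + η)                             ≡⟨ cong (λ z → z * z) (deg-p j) ⟩
        (h j + deg f j) * (h j + deg f j)             ∎
        where
        d = deg p j
        η = deg H j
        d+η : d + η ≡ D
        d+η = trans (deg-p j) (trans (cong₂ _+_ (deg-hit-∈ j eq) (deg-∈R f⊆ j eq)) (+-identityʳ D))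
        square : ∀ d η → d * d + (d + η + d) * (η * 1) ≡ (d + η) * (d + η)
        square = solve-∀

      h*≡c* : ∀ g → (∀ A → g A ≡ true → avoid R A ≡ true) → ∀ j → h j * deg g j ≡ c * deg g j
      h*≡c* g g⊆ j with lookup R j in eq
      ... | false = cong (_* deg g j) (deg-hit-∉ j eq)
      ... | true rewrite deg-∈R {g} g⊆ j eq = trans (*-zeroʳ (h j)) (sym (*-zeroʳ c))

      -- The degrees in `g` vanish on `R`, and those in `hit R` equal `c` off `R`, so the cross term
      -- is 2c times the degree sum `# g * k`. Between `f` and a competitor of size `m` it changes
      -- by 2cke only.
      expand : ∀ g → (∀ A → g A ≡ true → avoid R A ≡ true) →
               ∑ᶠ (λ j → (h j + deg g j) * (h j + deg g j)) ≡ ∑h² + 2 * c * (# g * k) + ∑² g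
      expand g g⊆ = begin-equality
        ∑ᶠ (λ j → (h j + deg g j) * (h j + deg g j))
          ≡⟨ ∑-cong (allFin n) (λ j → trans (i′ (h j) (deg g j)) (trans (cong (λ z → h j * h j + 2 * z + deg g j * deg g j) (h*≡c* g g⊆ j)) (i″ (h j * h j) c (deg g j)))) ⟩
        ∑ᶠ (λ j → h j * h j + 2 * c * deg g j + deg g j * deg g j)
          ≡⟨ trans (∑-+ (allFin n) _ _) (cong (_+ ∑² g) (∑-+ (allFin n) _ _)) ⟩
        ∑h² + ∑ᶠ (λ j → 2 * c * deg g j) + ∑² g
          ≡⟨ cong (λ z → ∑h² + z + ∑² g) (trans (∑-*ˡ (allFin n) (2 * c) (deg g)) (cong (2 * c *_) (∑-deg g))) ⟩
        ∑h² + 2 * c * (# g * k) + ∑² g ∎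
        where
        i′ : ∀ a b → (a + b) * (a + b) ≡ a * a + 2 * (a * b) + b * b
        i′ = solve-∀
        i″ : ∀ a c b → a + 2 * (c * b) + b * b ≡ a + 2 * c * b + b * b
        i″ = solve-∀

    module Large (scale : Scale n k s m K) (0<m : 0 < m) (m≤E : m ≤ E) where

      open Scale scale

      m≤D : m ≤ D
      m≤D = ≤-trans m≤E E≤D

      ck≤β : c * k ≤ β
      ck≤β = ≤-trans (*-monoˡ-≤ k (≤-trans c≤ (*-monoˡ-≤ K (n≤1+n r)))) sKk≤β

      #-avoid-star : # (avoid R ⟨ x ⟩) ≡ E
      #-avoid-star = trans (∑-cong U λ A → 𝟙-∧ (avoid R A) (lookup A x)) (deg-avoid R x x∉R)

      #-star : ∀ g → (∀ A → A ∈ₗ U → g A ≡ true → lookup A x ≡ true) → deg g x ≡ # g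
      #-star g g⊆ = ∑-cong-∈ U eq
        where
        eq : ∀ A → A ∈ₗ U → 𝟙 (g A) * 𝟙 (lookup A x) ≡ 𝟙 (g A)
        eq A A∈U with g A in gA
        ... | false = refl
        ... | true  = cong (λ b → 1 * 𝟙 b) (g⊆ A A∈U gA)

      -- There are `E ≥ m` sets through `x` that avoid `R`, so the competitor exists; of its squared
      -- degrees only the one at `x` is retained.
      star-bound : m * m + (D + u) * e ≤ 2 * (β * e) + ∑ᶠ (λ j → deg f j * deg f j)
      star-bound with select _≟ₛ_ (kSubsets-unique n k) (avoid R ⟨ x ⟩) m (≤-trans m≤E (≤-reflexive (sym #-avoid-star)))
      ... | g , g⊆ , #g = begin
        m * m + (D + u) * e
          ≡⟨ cong (λ z → z * z + (D + u) * e) (trans (#-star g λ A _ gA → proj₂ (∧⁻ (avoid R A) (g⊆ A gA))) #g) ⟨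
        deg g x * deg g x + (D + u) * e
          ≤⟨ +-monoˡ-≤ _ (∑-∈ (λ j → deg g j * deg g j) (∈-allFin x)) ⟩
        ∑ᶠ (λ j → deg g j * deg g j) + (D + u) * e
          ≤⟨ compare g (λ A gA → proj₁ (∧⁻ (avoid R A) (g⊆ A gA))) #g ⟩
        2 * (c * (k * e)) + ∑ᶠ (λ j → deg f j * deg f j)
          ≤⟨ +-monoˡ-≤ _ (*-monoʳ-≤ 2 (≤-trans (≤-reflexive (sym (*-assoc c k e))) (*-monoˡ-≤ e ck≤β))) ⟩
        2 * (β * e) + ∑ᶠ (λ j → deg f j * deg f j) ∎
        where open ≤-Reasoning

      ∑-deg-f≤ : ∀ S → # (f ∧ᶠ avoid S) + ∑ᶠ (λ j → deg f j * 𝟙 (lookup S j)) ≤ m + e + ∣ S ∣ * (∣ S ∣ * K)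
      ∑-deg-f≤ S = ≤-trans (bonferroni f S) (≤-reflexive (cong (_+ ∣ S ∣ * (∣ S ∣ * K)) #f))

      -- A crude cap on `m + e` in terms of `D`; it lets `u-large` compare the threshold `v` with
      -- `D` however large `e` is.
      #f≤sD : # f ≤ s * D
      #f≤sD = begin
        # f                                              ≤⟨ ∑-mono U (λ A → 𝟙-mono (f⊆p A)) ⟩
        # p                                              ≡⟨ #p ⟩
        # (hit R) + m                                    ≤⟨ +-mono-≤ (#≤∑-deg (hit R) R (λ _ h → h)) m≤D ⟩
        ∑ᶠ (λ j → deg (hit R) j * 𝟙 (lookup R j)) + D    ≤⟨ +-monoˡ-≤ D (∑-mono (allFin n) λ j → *-monoˡ-≤ (𝟙 (lookup R j)) (≤-trans (m≤m+n (deg (hit R) j) (deg (avoid R) j)) (≤-reflexive (deg-hit j)))) ⟩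
        ∑ᶠ (λ j → D * 𝟙 (lookup R j)) + D                ≡⟨ cong (_+ D) (trans (∑-*ˡ (allFin n) D _) (cong (D *_) (sym (∣∣-∑ R)))) ⟩
        D * r + D                                        ≡⟨ trans (+-comm (D * r) D) (cong (D +_) (*-comm D r)) ⟩
        s * D                                            ∎
        where open ≤-Reasoning

      -- Outside the 4ks elements of largest degree, the degrees are too small for k of them to matter.
      u-large : m + e + 6 * β < 2 * u
      u-large with largest (deg f) ℓ ℓ≤n
      ... | T , v , ∣T∣ , v≤T , T≤v = large-degree {m} {e} {u} {D} {β} {S} {P} {k * v} star-bound tail hC hD hE 100β≤m m≤D 0<m
        where
        open ≤-Reasoning
        S P : ℕ
        S = ∑ᶠ (λ j → deg f j * 𝟙 (lookup T j))
        P = # (f ∧ᶠ avoid T)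

        tail : ∑ᶠ (λ j → deg f j * deg f j) ≤ u * S + 4 * β * (m + e) + P * (k * v)
        tail = begin
          ∑ᶠ (λ j → deg f j * deg f j)
            ≤⟨ ∑-mono (allFin n) ptwise ⟩
          ∑ᶠ (λ j → u * (deg f j * 𝟙 (lookup T j)) + ∣ T ∣ * K * deg f j + deg (f ∧ᶠ avoid T) j * v)
            ≡⟨ trans (∑-+ (allFin n) _ _) (cong₂ _+_ (∑-+ (allFin n) _ _) (trans (∑-*ʳ (allFin n) _ v) (cong (_* v) (∑-deg (f ∧ᶠ avoid T))))) ⟩
          ∑ᶠ (λ j → u * (deg f j * 𝟙 (lookup T j))) + ∑ᶠ (λ j → ∣ T ∣ * K * deg f j) + P * k * v
            ≡⟨ cong₂ _+_ (cong₂ _+_ (∑-*ˡ (allFin n) u _) (trans (∑-*ˡ (allFin n) (∣ T ∣ * K) _)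
                 (cong₂ (λ t z → t * K * z) ∣T∣ (trans (∑-deg f) (cong (_* k) #f))))) (*-assoc P k v) ⟩
          u * S + ℓ * K * ((m + e) * k) + P * (k * v)
            ≡⟨ cong (λ z → u * S + z + P * (k * v)) (i (ℓ * K) (m + e) k) ⟩
          u * S + ℓ * K * k * (m + e) + P * (k * v)
            ≤⟨ +-monoˡ-≤ _ (+-monoʳ-≤ (u * S) (*-monoˡ-≤ (m + e) ℓKk≤4β)) ⟩
          u * S + 4 * β * (m + e) + P * (k * v) ∎
          where
          i : ∀ a b k → a * (b * k) ≡ a * k * b
          i = solve-∀
          -- On `T` one factor is at most `u`. Off `T`, at most `∣ T ∣ * K` members through `j` meet
          -- `T`; for those avoiding `T` the other factor is at most `v`, and summing over `j`
          -- charges `k * v` to each of the `P` members.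
          ptwise : ∀ j → deg f j * deg f j ≤ u * (deg f j * 𝟙 (lookup T j)) + ∣ T ∣ * K * deg f j + deg (f ∧ᶠ avoid T) j * v
          ptwise j with lookup T j in eq
          ... | true = begin
            deg f j * deg f j                    ≤⟨ *-monoˡ-≤ (deg f j) (f≤u j) ⟩
            u * deg f j                          ≡⟨ cong (u *_) (*-identityʳ (deg f j)) ⟨
            u * (deg f j * 1)                    ≤⟨ ≤-trans (m≤m+n _ _) (m≤m+n _ _) ⟩
            u * (deg f j * 1) + ∣ T ∣ * K * deg f j + deg (f ∧ᶠ avoid T) j * v ∎
          ... | false = begin
            deg f j * deg f j                                                  ≡⟨ cong (_* deg f j) (deg-split f (hit T) j) ⟩
            (deg (f ∧ᶠ hit T) j + deg (f ∧ᶠ avoid T) j) * deg f j              ≡⟨ *-distribʳ-+ (deg f j) (deg (f ∧ᶠ hit T) j) _ ⟩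
            deg (f ∧ᶠ hit T) j * deg f j + deg (f ∧ᶠ avoid T) j * deg f j      ≤⟨ +-mono-≤ (*-monoˡ-≤ (deg f j) (deg-hit≤ f T j eq)) (*-monoʳ-≤ (deg (f ∧ᶠ avoid T) j) (T≤v j eq)) ⟩
            ∣ T ∣ * K * deg f j + deg (f ∧ᶠ avoid T) j * v                     ≤⟨ +-monoˡ-≤ _ (m≤n+m _ (u * (deg f j * 0))) ⟩
            u * (deg f j * 0) + ∣ T ∣ * K * deg f j + deg (f ∧ᶠ avoid T) j * v ∎

        hC : P + S ≤ m + e + 16 * β
        hC = ≤-trans (∑-deg-f≤ T) (+-monoʳ-≤ (m + e) (≤-trans (≤-reflexive (cong (λ t → t * (t * K)) ∣T∣)) ℓℓK≤16β))

        -- All `ℓ ≥ 4ks` points of `T` have degree at least `v`; this is what dictates the size of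
        -- `ℓ`.
        4sW≤S : s * (4 * (k * v)) ≤ S
        4sW≤S = begin
          s * (4 * (k * v))                   ≡⟨ i s k v ⟩
          v * (4 * (k * s))                   ≤⟨ *-monoʳ-≤ v 4ks≤ℓ ⟩
          v * ℓ                               ≡⟨ cong (v *_) (trans (sym ∣T∣) (∣∣-∑ T)) ⟩
          v * ∑ᶠ (λ j → 𝟙 (lookup T j))       ≡⟨ ∑-*ˡ (allFin n) v _ ⟨
          ∑ᶠ (λ j → v * 𝟙 (lookup T j))       ≤⟨ ∑-mono (allFin n) ptwise ⟩
          S                                   ∎
          where
          i : ∀ s k v → s * (4 * (k * v)) ≡ v * (4 * (k * s))
          i = solve-∀
          ptwise : ∀ j → v * 𝟙 (lookup T j) ≤ deg f j * 𝟙 (lookup T j)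
          ptwise j with lookup T j in eq
          ... | true  = *-monoˡ-≤ 1 (v≤T j eq)
          ... | false = ≤-reflexive (trans (*-zeroʳ v) (sym (*-zeroʳ (deg f j))))

        hE : 4 * (k * v) ≤ m + e + 16 * β
        hE = ≤-trans (≤-trans (m≤m+n _ (r * (4 * (k * v)))) 4sW≤S) (≤-trans (m≤n+m S P) hC)

        -- The factor `s` kept in `4sW≤S` cancels the one in `#f≤sD`.
        hD : 4 * (k * v) ≤ D + 16 * β
        hD = *-cancelˡ-≤ s (begin
          s * (4 * (k * v))   ≤⟨ ≤-trans 4sW≤S (≤-trans (m≤n+m S P) hC) ⟩
          m + e + 16 * β      ≡⟨ cong (_+ 16 * β) #f ⟨
          # f + 16 * β        ≤⟨ +-mono-≤ #f≤sD (m≤n*m (16 * β) s) ⟩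
          s * D + s * (16 * β) ≡⟨ *-distribˡ-+ s D _ ⟨
          s * (D + 16 * β)    ∎)

      #-hit-insert : # (hit (insert x R)) ≡ # (hit R) + E
      #-hit-insert = trans (#-hit (insert x R)) (trans (cong (sumBinoms n k) (∣insert∣ x R x∉R)) (cong (_+ E) (sym (#-hit R))))

      u≤insert : ∀ i → lookup (insert x R) i ≡ true → u ≤ deg p i
      u≤insert i i∈ with i Fin.≟ x
      ... | yes refl = f≤p x
      ... | no i≢x   = u≤R i (trans (sym (lookup∘update′ i≢x R true)) i∈)

      -- Off `R` a degree in F exceeds the degree in F′ by at most `c`, which costs `c * k ≤ β` over
      -- A. Adding `u` completes the degree sum in F′ to one over the `k + 1` points of
      -- `insert x A`, which `bonferroni` bounds by |F′| with an error of at most 5β. Hence the 6β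
      -- in `u-large`.
      light : ∀ A → A ∈ₗ U → f A ≡ true → lookup A x ≡ false → weight A + u ≤ m + e + 6 * β
      light A A∈U fA x∉A = begin
        weight A + u
          ≤⟨ +-monoˡ-≤ u (∑-mono (allFin n) ptwise) ⟩
        ∑ᶠ (λ j → c * 𝟙 (lookup A j) + deg f j * 𝟙 (lookup A j)) + u
          ≡⟨ cong (_+ u) (trans (∑-+ (allFin n) _ _) (cong (_+ fA-sum) (trans (∑-*ˡ (allFin n) c _) (cong (c *_) (trans (sym (∣∣-∑ A)) ∣A∣))))) ⟩
        c * k + fA-sum + u
          ≡⟨ trans (+-assoc (c * k) _ u) (cong (c * k +_) with-x) ⟩
        c * k + ∑ᶠ (λ j → deg f j * 𝟙 (lookup (insert x A) j))
          ≤⟨ +-mono-≤ ck≤β (≤-trans (m≤n+m _ _) (∑-deg-f≤ (insert x A))) ⟩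
        β + (m + e + ∣ insert x A ∣ * (∣ insert x A ∣ * K))
          ≡⟨ cong (λ t → β + (m + e + t * (t * K))) (trans (∣insert∣ x A x∉A) (cong suc ∣A∣)) ⟩
        β + (m + e + suc k * (suc k * K))
          ≤⟨ +-monoʳ-≤ β (+-monoʳ-≤ (m + e) [k+1]²K≤5β) ⟩
        β + (m + e + 5 * β)
          ≡⟨ i β (m + e) ⟩
        m + e + 6 * β ∎
        where
        open ≤-Reasoning
        fA-sum = ∑ᶠ (λ j → deg f j * 𝟙 (lookup A j))
        ∣A∣ = ∈-kSubsets⁻ A∈U
        i : ∀ b a → b + (a + 5 * b) ≡ a + 6 * b
        i = solve-∀
        A∩R : hit R A ≡ false
        A∩R = not-injective (f⊆ A fA)
        ptwise : ∀ j → deg p j * 𝟙 (lookup A j) ≤ c * 𝟙 (lookup A j) + deg f j * 𝟙 (lookup A j)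
        ptwise j with lookup A j in j∈A | lookup R j in j∈R
        ... | false | _     = ≤-reflexive (trans (*-zeroʳ (deg p j)) (sym (cong₂ _+_ (*-zeroʳ c) (*-zeroʳ (deg f j)))))
        ... | true  | true  = contradiction (trans (sym (hit⁺ R A j j∈R j∈A)) A∩R) λ ()
        ... | true  | false = ≤-trans (*-monoˡ-≤ 1 (≤-trans (m≤m+n _ (deg H j)) (≤-reflexive (trans (deg-p j) (cong (_+ deg f j) (deg-hit-∉ j j∈R))))))
                                (≤-reflexive (*-distribʳ-+ 1 c (deg f j)))
        with-x : fA-sum + u ≡ ∑ᶠ (λ j → deg f j * 𝟙 (lookup (insert x A) j))
        with-x = trans (cong (fA-sum +_) (sym (∑-δᶠ x (deg f)))) (trans (sym (∑-+ (allFin n) _ _)) (∑-cong (allFin n) pt))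
          where
          pt : ∀ j → deg f j * 𝟙 (lookup A j) + δ x j * deg f j ≡ deg f j * 𝟙 (lookup (insert x A) j)
          pt j with j Fin.≟ x
          ... | yes refl rewrite x∉A | lookup∘update x A true = trans (cong₂ _+_ (*-zeroʳ (deg f x)) (+-identityʳ (deg f x))) (sym (*-identityʳ _))
          ... | no j≢x rewrite lookup∘update′ j≢x A true = +-identityʳ _

      star : ∀ A → A ∈ₗ U → f A ≡ true → lookup A x ≡ true
      star A A∈U fA with lookup A x in x∈A
      ... | true  = refl
      ... | false = contradiction too-many (<⇒≱ (≤-trans (s≤s (+-monoʳ-≤ (# (hit R)) m≤E)) (≤-reflexive (+-comm 1 _))))
        where
        open ≤-Reasoning
        full : ∀ B → B ∈ₗ U → hit (insert x R) B ≡ true → p B ≡ true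
        full B B∈U hB with p B in pB
        ... | true  = refl
        ... | false with hit⁻ (insert x R) B hB
        ...   | i , i∈ , i∈B = contradiction (begin
          2 * u               ≡⟨ cong (u +_) (+-identityʳ u) ⟩
          u + u               ≤⟨ +-monoˡ-≤ u (u≤insert i i∈) ⟩
          deg p i + u         ≡⟨ cong (_+ u) (trans (cong (λ b → deg p i * 𝟙 b) i∈B) (*-identityʳ _)) ⟨
          deg p i * 𝟙 (lookup B i) + u ≤⟨ +-monoˡ-≤ u (∑-∈ (λ j → deg p j * 𝟙 (lookup B j)) (∈-allFin i)) ⟩
          weight B + u        ≤⟨ +-monoˡ-≤ u (exchange A∈U B∈U (f⊆p A fA) pB) ⟩
          weight A + u        ≤⟨ light A A∈U fA x∈A ⟩
          m + e + 6 * β       ∎) (<⇒≱ u-large)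

        A∌ : hit (insert x R) A ≡ false
        A∌ = trans (hit-insert x R A) (cong₂ _∨_ x∈A (not-injective (f⊆ A fA)))

        -- `A` itself avoids `insert x R`, so it is a further member of F; this extra 1 gives a
        -- contradiction even when `m = E`.
        ptwise : ∀ B → B ∈ₗ U → 𝟙 (hit (insert x R) B) + 𝟙 (does (B ≟ₛ A)) * 1 ≤ 𝟙 (p B)
        ptwise B B∈U with B ≟ₛ A
        ... | yes refl rewrite A∌ | f⊆p A fA = ≤-refl
        ... | no _ with hit (insert x R) B in hB
        ...   | false = z≤n
        ...   | true rewrite full B B∈U hB = ≤-refl

        too-many : # (hit R) + E + 1 ≤ # (hit R) + m
        too-many = begin
          # (hit R) + E + 1                                     ≡⟨ cong₂ _+_ #-hit-insert (∑-δ _≟ₛ_ (λ _ → 1) (kSubsets-unique n k) A∈U) ⟨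
          # (hit (insert x R)) + (∑[ B ∈ U ] (𝟙 (does (B ≟ₛ A)) * 1)) ≡⟨ ∑-+ U _ _ ⟨
          (∑[ B ∈ U ] (𝟙 (hit (insert x R) B) + 𝟙 (does (B ≟ₛ A)) * 1)) ≤⟨ ∑-mono-∈ U ptwise ⟩
          # p                                                   ≡⟨ #p ⟩
          # (hit R) + m                                         ∎

      u≡ : u ≡ m + e
      u≡ = trans (#-star f star) #f

      f≤K : ∀ j → j ≢ x → deg f j ≤ K
      f≤K j j≢x = ≤-trans (∑-mono-∈ U le) (≤-reflexive (codeg≡K x j j≢x))
        where
        le : ∀ A → A ∈ₗ U → 𝟙 (f A) * 𝟙 (lookup A j) ≤ 𝟙 (lookup A x) * 𝟙 (lookup A j)
        le A A∈U = *-monoˡ-≤ (𝟙 (lookup A j)) (𝟙-mono (star A A∈U))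

      -- Comparison with hit R ∪ g for g ⊆ f.
      D≤ : 0 < e → D ≤ m + 2 * ((c + K) * k)
      D≤ 0<e with select _≟ₛ_ (kSubsets-unique n k) f m (≤-trans (m≤m+n m e) (≤-reflexive (sym #f)))
      -- Apart from the squared degrees of `g`, which cancel, every term carries a factor `e`;
      -- dividing by it leaves a bound on `D` free of `e` once `m + e` is cancelled.
      ... | g , g⊆f , #g = +-cancelʳ-≤ (m + e) _ _ (*-cancelʳ-≤ _ _ e ⦃ >-nonZero 0<e ⦄
        (+-cancelˡ-≤ (∑ᶠ (λ j → deg g j * deg g j)) _ _ (begin
          ∑ᶠ (λ j → deg g j * deg g j) + (D + (m + e)) * e
            ≡⟨ cong (λ z → ∑ᶠ (λ j → deg g j * deg g j) + (D + z) * e) u≡ ⟨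
          ∑ᶠ (λ j → deg g j * deg g j) + (D + u) * e
            ≤⟨ compare g (λ A gA → f⊆ A (g⊆f A gA)) #g ⟩
          2 * (c * (k * e)) + ∑ᶠ (λ j → deg f j * deg f j)
            ≤⟨ +-monoʳ-≤ (2 * (c * (k * e))) (∑-mono (allFin n) ptwise) ⟩
          2 * (c * (k * e)) + ∑ᶠ (λ j → deg g j * deg g j + 2 * K * α j + δ x j * (e * (2 * m + e)))
            ≡⟨ cong (2 * (c * (k * e)) +_) (trans (∑-+ (allFin n) _ _) (cong₂ _+_ (trans (∑-+ (allFin n) _ _)
                 (cong (∑ᶠ (λ j → deg g j * deg g j) +_) (trans (∑-*ˡ (allFin n) (2 * K) α) (cong (2 * K *_) ∑α)))) (∑-δᶠ x _))) ⟩
          2 * (c * (k * e)) + (∑ᶠ (λ j → deg g j * deg g j) + 2 * K * (e * k) + e * (2 * m + e))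
            ≡⟨ i c k e K m (∑ᶠ (λ j → deg g j * deg g j)) ⟩
          ∑ᶠ (λ j → deg g j * deg g j) + (m + 2 * ((c + K) * k) + (m + e)) * e ∎)))
        where
        open ≤-Reasoning
        α : Fin n → ℕ
        α = deg (f ∧ᶠ (not ∘ g))
        i : ∀ c k e K m z → 2 * (c * (k * e)) + (z + 2 * K * (e * k) + e * (2 * m + e)) ≡ z + (m + 2 * ((c + K) * k) + (m + e)) * e
        i = solve-∀
        f≡g+α : ∀ j → deg f j ≡ deg g j + α j
        f≡g+α j = trans (deg-split f g j) (cong (_+ α j) (∑-cong U λ A → cong (λ b → 𝟙 b * 𝟙 (lookup A j)) (f∧g A)))
          where
          f∧g : ∀ A → f A ∧ g A ≡ g A
          f∧g A with g A in gA
          ... | false = ∧-zeroʳ (f A)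
          ... | true  = trans (∧-identityʳ (f A)) (g⊆f A gA)
        ∑α : ∑ᶠ α ≡ e * k
        ∑α = +-cancelˡ-≡ (m * k) _ _ (begin-equality
          m * k + ∑ᶠ α          ≡⟨ cong (_+ ∑ᶠ α) (trans (∑-deg g) (cong (_* k) #g)) ⟨
          ∑ᶠ (deg g) + ∑ᶠ α     ≡⟨ ∑-+ (allFin n) _ _ ⟨
          ∑ᶠ (λ j → deg g j + α j) ≡⟨ ∑-cong (allFin n) f≡g+α ⟨
          ∑ᶠ (deg f)            ≡⟨ trans (∑-deg f) (cong (_* k) #f) ⟩
          (m + e) * k           ≡⟨ *-distribʳ-+ k m e ⟩
          m * k + e * k         ∎)
        -- At `x` the degrees are the sizes `m + e` and `m`. Elsewhere the difference of squares is
        -- `α j` times a sum of two degrees, each at most `K` because all members contain `x`.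
        ptwise : ∀ j → deg f j * deg f j ≤ deg g j * deg g j + 2 * K * α j + δ x j * (e * (2 * m + e))
        ptwise j with j Fin.≟ x
        ... | yes refl = begin
          u * u                                                       ≡⟨ cong (λ z → z * z) u≡ ⟩
          (m + e) * (m + e)                                           ≡⟨ sq m e ⟩
          m * m + (e * (2 * m + e) + 0)                               ≤⟨ +-monoˡ-≤ _ (m≤m+n (m * m) (2 * K * α x)) ⟩
          m * m + 2 * K * α x + (e * (2 * m + e) + 0)                 ≡⟨ cong (λ z → z * z + 2 * K * α x + (e * (2 * m + e) + 0)) g-x ⟨
          deg g x * deg g x + 2 * K * α x + (e * (2 * m + e) + 0)     ∎
          where
          g-x : deg g x ≡ m
          g-x = trans (#-star g λ A A∈U gA → star A A∈U (g⊆f A gA)) #g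
          sq : ∀ m e → (m + e) * (m + e) ≡ m * m + (e * (2 * m + e) + 0)
          sq = solve-∀
        ... | no j≢x = begin
          deg f j * deg f j                                 ≡⟨ cong (λ z → z * z) (f≡g+α j) ⟩
          (γ + α j) * (γ + α j)                             ≤⟨ m≤m+n _ (α j * α j) ⟩
          (γ + α j) * (γ + α j) + α j * α j                 ≡⟨ sq γ (α j) ⟩
          γ * γ + 2 * (γ + α j) * α j                       ≤⟨ +-monoʳ-≤ (γ * γ) (*-monoˡ-≤ (α j) (*-monoʳ-≤ 2 (≤-trans (≤-reflexive (sym (f≡g+α j))) (f≤K j j≢x)))) ⟩
          γ * γ + 2 * K * α j                               ≡⟨ +-identityʳ _ ⟨
          γ * γ + 2 * K * α j + 0                           ∎
          where
          γ = deg g j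
          sq : ∀ g a → (g + a) * (g + a) + a * a ≡ g * g + 2 * (g + a) * a
          sq = solve-∀

      R-full : m ≡ E ⊎ m + 2 * (s * K * k) < D → ∀ B → B ∈ₗ U → hit R B ≡ true → p B ≡ true
      R-full small B B∈U hB with p B in pB
      ... | true  = refl
      ... | false = contradiction small impossible
        where
        open ≤-Reasoning
        0<e : 0 < e
        0<e = ≤-trans (≤-reflexive (cong 𝟙 (sym (cong₂ (λ a b → a ∧ not b) hB pB)))) (∑-∈ (𝟙 ∘ H) B∈U)
        impossible : ¬ (m ≡ E ⊎ m + 2 * (s * K * k) < D)
        impossible (inj₂ m<)  = contradiction (begin
          D                       ≤⟨ D≤ 0<e ⟩
          m + 2 * ((c + K) * k)   ≤⟨ +-monoʳ-≤ m (*-monoʳ-≤ 2 (*-monoˡ-≤ k (≤-trans (+-monoˡ-≤ K c≤) (≤-reflexive (+-comm (r * K) K))))) ⟩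
          m + 2 * (s * K * k)     ∎) (<⇒≱ m<)
        impossible (inj₁ m≡E) = contradiction (begin
          m + e                ≡⟨ u≡ ⟨
          u                    ≤⟨ deg-mono f⊆ x ⟩
          deg (avoid R) x      ≡⟨ deg-avoid R x x∉R ⟩
          E                    ≡⟨ m≡E ⟨
          m                    ∎) (<⇒≱ (≤-trans (≤-reflexive (+-comm 1 m)) (+-monoʳ-≤ m 0<e)))

      cover : ∀ A → A ∈ₗ U → p A ≡ true → hit (insert x R) A ≡ true
      cover A A∈U pA with hit R A in hA
      ... | true  = trans (hit-insert x R A) (trans (cong (lookup A x ∨_) hA) (∨-zeroʳ _))
      ... | false = trans (hit-insert x R A) (cong (_∨ hit R A) (star A A∈U (cong₂ (λ a b → a ∧ not b) pA hA)))

-- Families as lists and as Boolean predicates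

mem : ∀ {n} → List (Subset n) → Subset n → Bool
mem []      A = false
mem (B ∷ F) A = does (A ≟ₛ B) ∨ mem F A

mem⁺ : ∀ {n} {F : List (Subset n)} {A} → A ∈ₗ F → mem F A ≡ true
mem⁺ {A = A} (here {B} A≡B) with A ≟ₛ B
... | yes _  = refl
... | no A≢B = contradiction A≡B A≢B
mem⁺ {F = B ∷ F} {A} (there A∈F) = trans (cong (does (A ≟ₛ B) ∨_) (mem⁺ A∈F)) (∨-zeroʳ _)

mem⁻ : ∀ {n} (F : List (Subset n)) {A} → mem F A ≡ true → A ∈ₗ F
mem⁻ (B ∷ F) {A} h with A ≟ₛ B
... | yes A≡B = here A≡B
... | no _    = there (mem⁻ F h)

module _ {n k : ℕ} where

  -- Agreement is tested against every weight `w`, so sizes and degrees are both special cases.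
  Represents : List (Subset n) → (Subset n → Bool) → Set
  Represents F p = ∀ w → ∑ F w ≡ ∑[ A ∈ kSubsets n k ] (𝟙 (p A) * w A)

  mem-represents : ∀ {F} → IsFamily n k F → Represents F (mem F)
  mem-represents {[]}    _ w = sym (∑-0 (kSubsets n k))
  mem-represents {B ∷ F} (B∉F ∷ uF , ∣B∣ ∷ kF) w = sym (begin
    (∑[ A ∈ U ] (𝟙 (mem (B ∷ F) A) * w A))
      ≡⟨ ∑-cong U (λ A → trans (cong (_* w A) (disjoint A)) (*-distribʳ-+ (w A) (𝟙 (does (A ≟ₛ B))) _)) ⟩
    (∑[ A ∈ U ] (𝟙 (does (A ≟ₛ B)) * w A + 𝟙 (mem F A) * w A))
      ≡⟨ ∑-+ U _ _ ⟩
    (∑[ A ∈ U ] (𝟙 (does (A ≟ₛ B)) * w A)) + (∑[ A ∈ U ] (𝟙 (mem F A) * w A))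
      ≡⟨ cong₂ _+_ (∑-δ _≟ₛ_ w (kSubsets-unique n k) (∈-kSubsets⁺ ∣B∣)) (sym (mem-represents (uF , kF) w)) ⟩
    w B + ∑ F w ∎)
    where
    open ≡-Reasoning
    U = kSubsets n k
    disjoint : ∀ A → 𝟙 (does (A ≟ₛ B) ∨ mem F A) ≡ 𝟙 (does (A ≟ₛ B)) + 𝟙 (mem F A)
    disjoint A with A ≟ₛ B | mem F A in A∈F
    ... | no _     | _     = refl
    ... | yes _    | false = refl
    ... | yes refl | true  = contradiction refl (All.lookup B∉F (mem⁻ F A∈F))

  filter-isFamily : ∀ q → IsFamily n k (filterᵇ q (kSubsets n k))
  filter-isFamily q = Unique.filter⁺ (T? ∘ q) (kSubsets-unique n k) ,
    All.tabulate λ A∈ → ∈-kSubsets⁻ (proj₁ (∈-filter⁻ (T? ∘ q) {xs = kSubsets n k} A∈))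

module _ (n k′ : ℕ) where
  open Counting n k′

  length-# : ∀ F p → Represents F p → length F ≡ # p
  length-# F p F≈p = trans (∑-length F) (trans (F≈p (λ _ → 1)) (∑-cong U λ A → *-identityʳ _))

  totalIntersection-deg : ∀ F p → Represents F p → totalIntersection F ≡ ∑ᶠ (λ j → deg p j * deg p j)
  totalIntersection-deg F p F≈p = begin
    totalIntersection F
      ≡⟨ ∑-cong F (λ A → trans (∑-cong F (∣∩∣-∑ A)) (∑-swap F (allFin n) _)) ⟩
    (∑[ A ∈ F ] ∑ᶠ (λ j → ∑[ B ∈ F ] (𝟙 (lookup A j) * 𝟙 (lookup B j))))
      ≡⟨ ∑-swap F (allFin n) _ ⟩
    ∑ᶠ (λ j → ∑[ A ∈ F ] ∑[ B ∈ F ] (𝟙 (lookup A j) * 𝟙 (lookup B j)))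
      ≡⟨ ∑-cong (allFin n) (λ j → trans (∑-cong F λ A → ∑-*ˡ F (𝟙 (lookup A j)) _) (∑-*ʳ F _ _)) ⟩
    ∑ᶠ (λ j → (∑[ A ∈ F ] 𝟙 (lookup A j)) * (∑[ B ∈ F ] 𝟙 (lookup B j)))
      ≡⟨ ∑-cong (allFin n) (λ j → cong (λ d → d * d) (F≈p (λ A → 𝟙 (lookup A j)))) ⟩
    ∑ᶠ (λ j → deg p j * deg p j) ∎
    where open ≡-Reasoning

  attainsMI⇒optimal : ∀ F p → Represents F p → AttainsMI n k F → Optimal p
  attainsMI⇒optimal F p F≈p max q #q≡#p = begin
    ∑ᶠ (λ j → deg q j * deg q j)   ≡⟨ totalIntersection-deg G q G≈q ⟨
    totalIntersection G            ≤⟨ max G (filter-isFamily q) (trans (length-# G q G≈q) (trans #q≡#p (sym (length-# F p F≈p)))) ⟩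
    totalIntersection F            ≡⟨ totalIntersection-deg F p F≈p ⟩
    ∑ᶠ (λ j → deg p j * deg p j)   ∎
    where
    open ≤-Reasoning
    G = filterᵇ q U
    G≈q : Represents G q
    G≈q = ∑-filter q U

-- Lexicographic initial segments

prefix : ∀ n → ℕ → Subset n
prefix zero    r       = []
prefix (suc n) zero    = false ∷ prefix n zero
prefix (suc n) (suc r) = true ∷ prefix n r

lookup-prefix : ∀ {n} r (i : Fin n) → lookup (prefix n r) i ≡ (toℕ i <ᵇ r)
lookup-prefix zero    zero    = refl
lookup-prefix zero    (suc i) = lookup-prefix zero i
lookup-prefix (suc r) zero    = refl
lookup-prefix (suc r) (suc i) = lookup-prefix r i

∣prefix∣ : ∀ n r → r ≤ n → ∣ prefix n r ∣ ≡ r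
∣prefix∣ zero    zero    _         = refl
∣prefix∣ (suc n) zero    _         = ∣prefix∣ n zero z≤n
∣prefix∣ (suc n) (suc r) (s≤s r≤n) = cong suc (∣prefix∣ n r r≤n)

hit-prefix-zero : ∀ {n} (A : Subset n) → hit (prefix n zero) A ≡ false
hit-prefix-zero []      = refl
hit-prefix-zero (a ∷ A) = hit-prefix-zero A

-- With `hit-lex`, this says that the sets meeting the first `r` points form an initial segment of
-- the lexicographic order. `InL` can then be decided by counting alone.
lex-hit : ∀ {n} r (A B : Subset n) → lexBefore A B ≡ true → hit (prefix n r) B ≡ true → hit (prefix n r) A ≡ true
lex-hit zero    A           B           _   hB = contradiction (trans (sym hB) (hit-prefix-zero B)) λ ()
lex-hit (suc r) (true ∷ A)  (b ∷ B)     _   _  = refl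
lex-hit (suc r) (false ∷ A) (false ∷ B) A<B hB = lex-hit r A B A<B hB

hit-lex : ∀ {n} r (A B : Subset n) → hit (prefix n r) A ≡ true → hit (prefix n r) B ≡ false → lexBefore A B ≡ true
hit-lex zero    A           B           hA _  = contradiction (trans (sym hA) (hit-prefix-zero A)) λ ()
hit-lex (suc r) (true ∷ A)  (false ∷ B) _  _  = refl
hit-lex (suc r) (false ∷ A) (false ∷ B) hA hB = hit-lex r A B hA hB

lex-irrefl : ∀ {n} (A : Subset n) → lexBefore A A ≡ false
lex-irrefl []          = refl
lex-irrefl (true ∷ A)  = lex-irrefl A
lex-irrefl (false ∷ A) = lex-irrefl A

module _ (n k′ r : ℕ) (r<n : r < n) where
  open Counting n k′

  lexSize≡ : lexSize n k 1 r ≡ # (hit (prefix n r))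
  lexSize≡ = begin
    ((n ∸ 1 + 1) C (k′ + 1)) ∸ ((n ∸ r) C (k′ + 1)) ≡⟨ cong₂ (λ a b → (a C b) ∸ ((n ∸ r) C b)) (m∸n+n≡m (≤-trans (s≤s z≤n) r<n)) (+-comm k′ 1) ⟩
    (n C k) ∸ ((n ∸ r) C k)                          ≡⟨ cong (_∸ ((n ∸ r) C k)) (sumBinoms-C n k′ r (<⇒≤ r<n)) ⟨
    sumBinoms n k r + (n ∸ r) C k ∸ ((n ∸ r) C k)    ≡⟨ m+n∸n≡m (sumBinoms n k r) ((n ∸ r) C k) ⟩
    sumBinoms n k r                                  ≡⟨ cong (sumBinoms n k) (∣prefix∣ n r (<⇒≤ r<n)) ⟨
    sumBinoms n k ∣ prefix n r ∣                     ≡⟨ #-hit (prefix n r) ⟨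
    # (hit (prefix n r))                             ∎
    where open ≡-Reasoning

  rankLex≡ : ∀ B → rankLex n k B ≡ # (λ A → lexBefore A B)
  rankLex≡ B = trans (∑-length (filterᵇ _ (allSubsets n))) (trans (∑-filter _ (allSubsets n) (λ _ → 1))
    (trans (∑-cong (allSubsets n) λ A → trans (*-identityʳ _) (𝟙-∧ (∣ A ∣ ≡ᵇ k) _))
           (sym (∑-filter _ (allSubsets n) _))))

  InL⁺ : ∀ {B} → ∣ B ∣ ≡ k → hit (prefix n r) B ≡ true → InL n k 1 r B
  InL⁺ {B} ∣B∣ hB = ∣B∣ , (begin
    suc (rankLex n k B)                 ≡⟨ trans (cong suc (rankLex≡ B)) (+-comm 1 _) ⟩
    # (λ A → lexBefore A B) + 1         ≡⟨ cong (# (λ A → lexBefore A B) +_) (∑-δ _≟ₛ_ (λ _ → 1) (kSubsets-unique n k) (∈-kSubsets⁺ ∣B∣)) ⟨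
    # (λ A → lexBefore A B) + (∑[ A ∈ U ] (𝟙 (does (A ≟ₛ B)) * 1)) ≡⟨ ∑-+ U _ _ ⟨
    (∑[ A ∈ U ] (𝟙 (lexBefore A B) + 𝟙 (does (A ≟ₛ B)) * 1)) ≤⟨ ∑-mono U ptwise ⟩
    # (hit (prefix n r))                ≡⟨ lexSize≡ ⟨
    lexSize n k 1 r                     ∎)
    where
    open ≤-Reasoning
    -- `B` is counted along with its predecessors, which makes the bound on the rank strict.
    ptwise : ∀ A → 𝟙 (lexBefore A B) + 𝟙 (does (A ≟ₛ B)) * 1 ≤ 𝟙 (hit (prefix n r) A)
    ptwise A with A ≟ₛ B
    ... | yes refl rewrite lex-irrefl A | hB = ≤-refl
    ... | no _ = ≤-trans (≤-reflexive (+-identityʳ _)) (𝟙-mono λ A<B → lex-hit r A B A<B hB)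

  InL⁻ : ∀ {B} → InL n k 1 r B → ∣ B ∣ ≡ k × hit (prefix n r) B ≡ true
  InL⁻ {B} (∣B∣ , rank<) = ∣B∣ , hits
    where
    hits : hit (prefix n r) B ≡ true
    hits with hit (prefix n r) B in hB
    ... | true  = refl
    ... | false = contradiction rank< (≤⇒≯ (≤-trans (≤-reflexive lexSize≡)
      (≤-trans (∑-mono U λ A → 𝟙-mono λ hA → hit-lex r A B hA hB) (≤-reflexive (sym (rankLex≡ B))))))

-- Permutations carrying a given set to an initial segment

Aligned : ∀ {n} → Permutation′ n → Subset n → ℕ → Set
Aligned σ S s = ∀ j → lookup S j ≡ (toℕ (σ ⟨$⟩ʳ j) <ᵇ s)

<ᵇ-true : ∀ {a b} → a < b → (a <ᵇ b) ≡ true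
<ᵇ-true a<b = Equivalence.to T-≡ (<⇒<ᵇ a<b)

<ᵇ-false : ∀ {a b} → b ≤ a → (a <ᵇ b) ≡ false
<ᵇ-false {a} {b} b≤a with a <ᵇ b in eq
... | false = refl
... | true  = contradiction (<ᵇ⇒< a b (Equivalence.from T-≡ eq)) (≤⇒≯ b≤a)

≢⇒<ᵇ-suc : ∀ a b → a ≢ b → (a <ᵇ b) ≡ (a <ᵇ suc b)
≢⇒<ᵇ-suc a b a≢b with ≤-total a b
... | inj₁ a≤b = trans (<ᵇ-true (≤∧≢⇒< a≤b a≢b)) (sym (<ᵇ-true (s≤s a≤b)))
... | inj₂ b≤a = trans (<ᵇ-false b≤a) (sym (<ᵇ-false (≤∧≢⇒< b≤a (a≢b ∘ sym))))

-- A single permutation must serve both inclusions of the sandwich, so `S` has to stay aligned while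
-- `x` is added. Swapping the position of `x` with position `s` achieves this, as both are at least
-- `s`.
align-insert : ∀ {n} (σ : Permutation′ n) S {s} x → Aligned σ S s → lookup S x ≡ false → s < n →
               ∃[ τ ] (Aligned τ S s × Aligned τ (insert x S) (suc s))
align-insert {n} σ S {s} x aligned x∉S s<n = τ , (λ j → proj₁ (both j)) , (λ j → proj₂ (both j))
  where
  y = fromℕ< s<n
  z = σ ⟨$⟩ʳ x
  τ = σ ∘ₚ transpose z y

  s≤z : s ≤ toℕ z
  s≤z = ≮⇒≥ λ z<s → contradiction (trans (sym x∉S) (trans (aligned x) (<ᵇ-true z<s))) λ ()

  both : ∀ j → lookup S j ≡ (toℕ (τ ⟨$⟩ʳ j) <ᵇ s) × lookup (insert x S) j ≡ (toℕ (τ ⟨$⟩ʳ j) <ᵇ suc s)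
  both j with σ ⟨$⟩ʳ j Fin.≟ z
  ... | yes σj≡z with refl ← trans (sym (inverseˡ σ)) (trans (cong (σ ⟨$⟩ˡ_) σj≡z) (inverseˡ σ)) =
    trans x∉S (sym (<ᵇ-false (≤-reflexive (sym (toℕ-fromℕ< s<n))))) ,
    trans (lookup∘update x S true) (sym (<ᵇ-true (≤-reflexive (cong suc (toℕ-fromℕ< s<n)))))
  ... | no σj≢z with σ ⟨$⟩ʳ j Fin.≟ y
  ...   | yes σj≡y =
    trans S∌j (sym (<ᵇ-false s≤z)) ,
    trans (lookup∘update′ j≢x S true) (trans S∌j (sym (<ᵇ-false (≤∧≢⇒< s≤z s≢z))))
    where
    j≢x : j ≢ x
    j≢x refl = σj≢z refl
    σj≡s : toℕ (σ ⟨$⟩ʳ j) ≡ s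
    σj≡s = trans (cong toℕ σj≡y) (toℕ-fromℕ< s<n)
    S∌j : lookup S j ≡ false
    S∌j = trans (aligned j) (<ᵇ-false (≤-reflexive (sym σj≡s)))
    s≢z : s ≢ toℕ z
    s≢z s≡z = σj≢z (toℕ-injective (trans σj≡s s≡z))
  ...   | no σj≢y = aligned j , trans (lookup∘update′ j≢x S true) (trans (aligned j)
    (≢⇒<ᵇ-suc (toℕ (σ ⟨$⟩ʳ j)) s λ σj≡s → σj≢y (toℕ-injective (trans σj≡s (sym (toℕ-fromℕ< s<n))))))
    where
    j≢x : j ≢ x
    j≢x refl = σj≢z refl

nonempty : ∀ {n} (S : Subset n) {s} → ∣ S ∣ ≡ suc s → ∃[ i ] lookup S i ≡ true
nonempty (true ∷ S)  _   = zero , refl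
nonempty (false ∷ S) ∣S∣ = let i , i∈S = nonempty S ∣S∣ in suc i , i∈S

align : ∀ {n} s (S : Subset n) → ∣ S ∣ ≡ s → ∃[ σ ] Aligned σ S s
align {n} zero S ∣S∣≡0 = id , λ j → trans (S∌ j) (sym (<ᵇ-false {toℕ j} z≤n))
  where
  S∌ : ∀ j → lookup S j ≡ false
  S∌ j with lookup S j in eq
  ... | false = refl
  ... | true  = contradiction (≤-trans (≤-reflexive (cong 𝟙 (sym eq))) (≤-trans (∑-∈ (𝟙 ∘ lookup S) (∈-allFin j))
                  (≤-reflexive (trans (sym (∣∣-∑ S)) ∣S∣≡0)))) λ ()
align {n} (suc s) S ∣S∣≡ with nonempty S ∣S∣≡
... | x , x∈S = let σ , aligned = align s S′ ∣S′∣
                    τ , _ , aligned′ = align-insert σ S′ x aligned (lookup∘update x S false) (≤-trans (≤-reflexive (sym ∣S∣≡)) (∣p∣≤n S))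
                in τ , subst (λ S → Aligned τ S (suc s)) S′+x aligned′
  where
  S′ = S [ x ]≔ false
  S′+x : insert x S′ ≡ S
  S′+x = trans ([]≔-idempotent S x) (trans (cong (S [ x ]≔_) (sym x∈S)) ([]≔-lookup S x))
  ∣S′∣ : ∣ S′ ∣ ≡ s
  ∣S′∣ = suc-injective (trans (sym (∣insert∣ x S′ (lookup∘update x S false))) (trans (cong ∣_∣ S′+x) ∣S∣≡))

lookup-image : ∀ {n} (σ : Permutation′ n) A i → lookup (image σ A) i ≡ lookup A (σ ⟨$⟩ˡ i)
lookup-image σ A = lookup∘tabulate _

hit-image : ∀ {n} (σ : Permutation′ n) {S s} → Aligned σ S s → ∀ A → hit (prefix n s) (image σ A) ≡ hit S A
hit-image {n} σ {S} {s} aligned A with hit S A in hA | hit (prefix n s) (image σ A) in hσA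
... | true  | true  = refl
... | false | false = refl
... | true  | false with hit⁻ S A hA
...   | j , j∈S , j∈A = trans (sym hσA) (hit⁺ (prefix n s) (image σ A) (σ ⟨$⟩ʳ j)
        (trans (lookup-prefix s (σ ⟨$⟩ʳ j)) (trans (sym (aligned j)) j∈S))
        (trans (lookup-image σ A _) (trans (cong (lookup A) (inverseˡ σ)) j∈A)))
hit-image {n} σ {S} {s} aligned A | false | true with hit⁻ (prefix n s) (image σ A) hσA
... | i , i∈P , i∈σA = trans (sym (hit⁺ S A (σ ⟨$⟩ˡ i)
        (trans (aligned _) (trans (cong (λ i → toℕ i <ᵇ s) (inverseʳ σ)) (trans (sym (lookup-prefix s i)) i∈P)))
        (trans (sym (lookup-image σ A i)) i∈σA))) hA

-- Each value is expanded as a sum against a Kronecker delta; after exchanging the sums, the delta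
-- is read from the other side of the bijection.
∑-permute : ∀ {n} (σ : Permutation′ n) (f : Fin n → ℕ) → ∑[ i ∈ allFin n ] f (σ ⟨$⟩ˡ i) ≡ ∑ (allFin n) f
∑-permute {n} σ f = begin
  (∑[ i ∈ allFin n ] f (σ ⟨$⟩ˡ i))
    ≡⟨ ∑-cong (allFin n) (λ i → ∑-δ Fin._≟_ f (Unique.allFin⁺ n) (∈-allFin (σ ⟨$⟩ˡ i))) ⟨
  (∑[ i ∈ allFin n ] ∑[ j ∈ allFin n ] (𝟙 (does (j Fin.≟ (σ ⟨$⟩ˡ i))) * f j))
    ≡⟨ ∑-swap (allFin n) (allFin n) _ ⟩
  (∑[ j ∈ allFin n ] ∑[ i ∈ allFin n ] (𝟙 (does (j Fin.≟ (σ ⟨$⟩ˡ i))) * f j))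
    ≡⟨ ∑-cong (allFin n) (λ j → ∑-cong (allFin n) λ i → cong (λ b → 𝟙 b * f j) (adjoint i j)) ⟩
  (∑[ j ∈ allFin n ] ∑[ i ∈ allFin n ] (𝟙 (does (i Fin.≟ (σ ⟨$⟩ʳ j))) * f j))
    ≡⟨ ∑-cong (allFin n) (λ j → ∑-δ Fin._≟_ (λ _ → f j) (Unique.allFin⁺ n) (∈-allFin (σ ⟨$⟩ʳ j))) ⟩
  ∑ (allFin n) f ∎
  where
  open ≡-Reasoning
  adjoint : ∀ i j → does (j Fin.≟ (σ ⟨$⟩ˡ i)) ≡ does (i Fin.≟ (σ ⟨$⟩ʳ j))
  adjoint i j with j Fin.≟ (σ ⟨$⟩ˡ i) | i Fin.≟ (σ ⟨$⟩ʳ j)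
  ... | yes _    | yes _    = refl
  ... | no _     | no _     = refl
  ... | yes refl | no i≢    = contradiction (sym (inverseʳ σ)) i≢
  ... | no j≢    | yes refl = contradiction (sym (inverseˡ σ)) j≢

∣image∣ : ∀ {n} (σ : Permutation′ n) A → ∣ image σ A ∣ ≡ ∣ A ∣
∣image∣ {n} σ A = begin
  ∣ image σ A ∣                                   ≡⟨ ∣∣-∑ (image σ A) ⟩
  (∑[ i ∈ allFin n ] 𝟙 (lookup (image σ A) i))    ≡⟨ ∑-cong (allFin n) (λ i → cong 𝟙 (lookup-image σ A i)) ⟩
  (∑[ i ∈ allFin n ] 𝟙 (lookup A (σ ⟨$⟩ˡ i)))     ≡⟨ ∑-permute σ (𝟙 ∘ lookup A) ⟩
  (∑[ i ∈ allFin n ] 𝟙 (lookup A i))              ≡⟨ ∣∣-∑ A ⟨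
  ∣ A ∣                                           ∎
  where open ≡-Reasoning

image-flip : ∀ {n} (σ : Permutation′ n) B → image σ (image (flip σ) B) ≡ B
image-flip σ B = trans (tabulate-cong λ i → trans (lookup-image (flip σ) B (σ ⟨$⟩ˡ i)) (cong (lookup B) (inverseʳ σ))) (tabulate∘lookup B)

-- Numerical consequences of the bounds on n and m

nCk>0 : ∀ n k → k ≤ n → 0 < n C k
nCk>0 n       zero    _         = s≤s z≤n
nCk>0 (suc n) (suc k) (s≤s k≤n) = ≤-trans (nCk>0 n k k≤n) (≤-trans (m≤m+n _ _) (≤-reflexive (nCk+nC[k+1]≡[n+1]C[k+1] n k)))

module Estimates (n k r D E K : ℕ) ⦃ _ : NonZero k ⦄
  (large : 3000 * (k * k * (suc r * suc r) * (k * suc r)) ≤ n)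
  (nK≤kD : n * K ≤ k * D) (D≤rK+E : D ≤ r * K + E) (E≤D : E ≤ D) (0<E : 0 < E)
  where

  open ≤-Reasoning

  s q : ℕ
  s = suc r
  q = k * k * (s * s)

  instance
    kk≢0 : NonZero (k * k)
    kk≢0 = m*n≢0 k k
    ks≢0 : NonZero (k * s)
    ks≢0 = m*n≢0 k s
    q≢0 : NonZero q
    q≢0 = m*n≢0 (k * k) (s * s)

  ks≤n : ∀ c → c ≤ 3000 → c * (k * s) ≤ n
  ks≤n c c≤ = ≤-trans (*-mono-≤ c≤ (m≤n*m (k * s) q)) large

  instance
    n≢0 : NonZero n
    n≢0 = >-nonZero (≤-trans (>-nonZero⁻¹ (k * s)) (≤-trans (≤-reflexive (sym (*-identityˡ (k * s)))) (ks≤n 1 (≤ᵇ⇒≤ 1 3000 _))))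

  -- The loss `r * K` is at most rkD/n, hence at most D/3.
  2D≤3E : 2 * D ≤ 3 * E
  2D≤3E = +-cancelˡ-≤ D _ _ (begin
    3 * D                  ≤⟨ *-monoʳ-≤ 3 D≤rK+E ⟩
    3 * (r * K + E)        ≡⟨ *-distribˡ-+ 3 (r * K) E ⟩
    3 * (r * K) + 3 * E    ≤⟨ +-monoˡ-≤ (3 * E) 3rK≤D ⟩
    D + 3 * E              ∎)
    where
    i : ∀ n r K → n * (3 * (r * K)) ≡ 3 * r * (n * K)
    i = solve-∀
    j : ∀ r k D → 3 * r * (k * D) ≡ 3 * (k * r) * D
    j = solve-∀
    3rK≤D : 3 * (r * K) ≤ D
    3rK≤D = *-cancelˡ-≤ n (begin
      n * (3 * (r * K))    ≡⟨ i n r K ⟩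
      3 * r * (n * K)      ≤⟨ *-monoʳ-≤ (3 * r) nK≤kD ⟩
      3 * r * (k * D)      ≡⟨ j r k D ⟩
      3 * (k * r) * D      ≤⟨ *-monoˡ-≤ D (≤-trans (*-monoʳ-≤ 3 (*-monoʳ-≤ k (n≤1+n r))) (ks≤n 3 (≤ᵇ⇒≤ 3 3000 _))) ⟩
      n * D                ∎)

  module _ (m : ℕ) (lower : 150 * (q * k) * E ≤ m * n) where

    0<m : 0 < m
    0<m = *-cancelʳ-< n 0 m (≤-trans (*-mono-≤ {1} {150 * (q * k)} (≤-trans (>-nonZero⁻¹ (q * k) ⦃ m*n≢0 q k ⦄) (m≤n*m (q * k) 150)) 0<E) lower)

    -- The chain is m ≥ 150qkE/n ≥ 100qkD/n ≥ 100qK, the middle step by `2D≤3E`.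
    100qK≤m : 100 * (q * K) ≤ m
    100qK≤m = *-cancelˡ-≤ n (begin
      n * (100 * (q * K))         ≡⟨ i n q K ⟩
      100 * q * (n * K)           ≤⟨ *-monoʳ-≤ (100 * q) nK≤kD ⟩
      100 * q * (k * D)           ≡⟨ j q k D ⟩
      50 * (q * k) * (2 * D)      ≤⟨ *-monoʳ-≤ (50 * (q * k)) 2D≤3E ⟩
      50 * (q * k) * (3 * E)      ≡⟨ l (q * k) E ⟩
      150 * (q * k) * E           ≤⟨ lower ⟩
      m * n                       ≡⟨ *-comm m n ⟩
      n * m                       ∎)
      where
      i : ∀ n q K → n * (100 * (q * K)) ≡ 100 * q * (n * K)
      i = solve-∀
      j : ∀ q k D → 100 * q * (k * D) ≡ 50 * (q * k) * (2 * D)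
      j = solve-∀
      l : ∀ q E → 50 * q * (3 * E) ≡ 150 * q * E
      l = solve-∀

    scale : Scale n k s m K
    scale = record
      { β = q * K
      ; ℓ = 4 * (k * s)
      ; 100β≤m = 100qK≤m
      ; sKk≤β = ≤-trans (≤-reflexive (i₁ s K k)) (*-monoˡ-≤ K (*-mono-≤ (m≤m*n k k) (m≤m*n s s)))
      ; ℓ≤n = ks≤n 4 (≤ᵇ⇒≤ 4 3000 _)
      ; 4ks≤ℓ = ≤-refl
      ; ℓKk≤4β = ≤-trans (≤-reflexive (i₂ k s K)) (*-monoʳ-≤ 4 (*-monoˡ-≤ K (*-monoʳ-≤ (k * k) (m≤m*n s s))))
      ; ℓℓK≤16β = ≤-reflexive (i₃ k s K)
      ; [k+1]²K≤5β = begin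
          suc k * (suc k * K)        ≡⟨ *-assoc (suc k) (suc k) K ⟨
          suc k * suc k * K          ≤⟨ *-monoˡ-≤ K (*-mono-≤ k+1≤2k k+1≤2k) ⟩
          (k + k) * (k + k) * K      ≡⟨ i₄ k K ⟩
          4 * (k * k * K)            ≤⟨ *-mono-≤ (≤ᵇ⇒≤ 4 5 _) (*-monoˡ-≤ K (m≤m*n (k * k) (s * s))) ⟩
          5 * (q * K)                ∎
      }
      where
      k+1≤2k : suc k ≤ k + k
      k+1≤2k = +-monoˡ-≤ k (>-nonZero⁻¹ k)
      i₁ : ∀ s K k → s * K * k ≡ k * s * K
      i₁ = solve-∀
      i₂ : ∀ k s K → 4 * (k * s) * K * k ≡ 4 * (k * k * s * K)
      i₂ = solve-∀
      i₃ : ∀ k s K → 4 * (k * s) * (4 * (k * s) * K) ≡ 16 * (k * k * (s * s) * K)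
      i₃ = solve-∀
      i₄ : ∀ k K → (k + k) * (k + k) * K ≡ 4 * (k * k * K)
      i₄ = solve-∀

  -- The error 2skK is at most 2k²sD/n ≤ 3k²sE/n, well below the gap 150k³s³E/n that `upper` leaves
  -- between `m` and `E`.
  m<D : ∀ m → m * n + 150 * (q * (k * s)) * E ≤ n * E → m + 2 * (s * K * k) < D
  m<D m upper = *-cancelˡ-< n _ _ (begin-strict
    n * (m + 2 * (s * K * k))               ≡⟨ i n m s K k ⟩
    m * n + 2 * (k * s) * (n * K)           ≤⟨ +-monoʳ-≤ (m * n) (*-monoʳ-≤ (2 * (k * s)) nK≤kD) ⟩
    m * n + 2 * (k * s) * (k * D)           ≡⟨ cong (m * n +_) (j k s D) ⟩
    m * n + k * k * s * (2 * D)             ≤⟨ +-monoʳ-≤ (m * n) (*-monoʳ-≤ (k * k * s) 2D≤3E) ⟩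
    m * n + k * k * s * (3 * E)             ≡⟨ cong (m * n +_) (l (k * k * s) E) ⟩
    m * n + 3 * (k * k * s) * E             ≤⟨ +-monoʳ-≤ (m * n) (*-monoˡ-≤ E (*-monoʳ-≤ 3 (≤-trans (*-monoʳ-≤ (k * k) (m≤m*n s s)) (m≤m*n q (k * s))))) ⟩
    m * n + 3 * (q * (k * s)) * E           <⟨ +-monoʳ-< (m * n) (*-monoˡ-< E ⦃ >-nonZero 0<E ⦄ (*-monoˡ-< (q * (k * s)) ⦃ m*n≢0 q (k * s) ⦄ (≤ᵇ⇒≤ 4 150 _))) ⟩
    m * n + 150 * (q * (k * s)) * E         ≤⟨ upper ⟩
    n * E                                   ≤⟨ *-monoʳ-≤ n E≤D ⟩
    n * D                                   ∎)
    where
    i : ∀ n m s K k → n * (m + 2 * (s * K * k)) ≡ m * n + 2 * (k * s) * (n * K)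
    i = solve-∀
    j : ∀ k s D → 2 * (k * s) * (k * D) ≡ k * k * s * (2 * D)
    j = solve-∀
    l : ∀ a E → a * (3 * E) ≡ 3 * a * E
    l = solve-∀

k+s≤n : ∀ {n} k r ⦃ _ : NonZero k ⦄ → 3000 * (k * k * (suc r * suc r) * (k * suc r)) ≤ n → k + suc r ≤ n
k+s≤n {n} k r large = begin
  k + s                                    ≤⟨ +-mono-≤ (m≤m*n k s) (m≤n*m s k) ⟩
  k * s + k * s                            ≡⟨ cong (k * s +_) (+-identityʳ (k * s)) ⟨
  2 * (k * s)                              ≤⟨ *-mono-≤ (≤ᵇ⇒≤ 2 3000 _) (m≤n*m (k * s) (k * k * (s * s)) ⦃ m*n≢0 (k * k) (s * s) ⦃ m*n≢0 k k ⦄ ⦄) ⟩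
  3000 * (k * k * (s * s) * (k * s))       ≤⟨ large ⟩
  n                                        ∎
  where
  open ≤-Reasoning
  s = suc r

3000k³s³≤n : ∀ {n} C₀ k r → 3000 ≤ C₀ → C₀ * (suc r ^ 3) * (k + r) * (k ^ 2) ≤ n →
           3000 * (k * k * (suc r * suc r) * (k * suc r)) ≤ n
3000k³s³≤n {n} C₀ k r 3000≤C₀ C₀≤n = begin
  3000 * (k * k * (s * s) * (k * s))        ≡⟨ i 3000 k s ⟩
  3000 * (s ^ 3) * k * (k ^ 2)              ≤⟨ *-monoˡ-≤ (k ^ 2) (*-mono-≤ (*-monoˡ-≤ (s ^ 3) 3000≤C₀) (m≤m+n k r)) ⟩
  C₀ * (s ^ 3) * (k + r) * (k ^ 2)          ≤⟨ C₀≤n ⟩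
  n                                         ∎
  where
  open ≤-Reasoning
  s = suc r
  i : ∀ a k s → a * (k * k * (s * s) * (k * s)) ≡ a * (s * (s * (s * 1))) * k * (k * (k * 1))
  i = solve-∀

-- `m` stands for δE, and the interval for δ has been multiplied by nE. For δ = 1 the lower bound
-- required of `m` comes from the one on `n`.
parameters : ∀ {C₀ k r n m D E K} ⦃ _ : NonZero k ⦄ → 3000 ≤ C₀ →
  C₀ * (suc r ^ 3) * (k + r) * (k ^ 2) ≤ n →
  ((150 * k ^ 3 * suc r ^ 2 * E ≤ m * n × m * n + 150 * k ^ 3 * suc r ^ 3 * E ≤ n * E) ⊎ m ≡ E) →
  n * K ≤ k * D → D ≤ r * K + E → E ≤ D → 0 < E →
  Scale n k (suc r) m K × 0 < m × m ≤ E × (m ≡ E ⊎ m + 2 * (suc r * K * k) < D)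
parameters {C₀} {k} {r} {n} {m} {D} {E} {K} 3000≤C₀ C₀≤n δ nK≤kD D≤rK+E E≤D 0<E = scale m (lower δ) , 0<m m (lower δ) , m≤E δ , small δ
  where
  open ≤-Reasoning

  large : 3000 * (k * k * (suc r * suc r) * (k * suc r)) ≤ n
  large = 3000k³s³≤n C₀ k r 3000≤C₀ C₀≤n

  open Estimates n k r D E K large nK≤kD D≤rK+E E≤D 0<E using (s; q; scale; 0<m; m<D; n≢0)

  i₁ : ∀ k s E → 150 * (k * k * (s * s) * k) * E ≡ 150 * (k * (k * (k * 1))) * (s * (s * 1)) * E
  i₁ = solve-∀
  i₂ : ∀ k s E → 150 * (k * k * (s * s) * (k * s)) * E ≡ 150 * (k * (k * (k * 1))) * (s * (s * (s * 1))) * E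
  i₂ = solve-∀

  Δ : Set
  Δ = (150 * k ^ 3 * s ^ 2 * E ≤ m * n × m * n + 150 * k ^ 3 * s ^ 3 * E ≤ n * E) ⊎ m ≡ E

  lower : Δ → 150 * (q * k) * E ≤ m * n
  lower (inj₁ (lo , _)) = ≤-trans (≤-reflexive (i₁ k s E)) lo
  lower (inj₂ m≡E)      = begin
    150 * (q * k) * E          ≤⟨ *-monoˡ-≤ E (≤-trans (*-mono-≤ (≤ᵇ⇒≤ 150 3000 _) (*-monoʳ-≤ q (m≤m*n k s))) large) ⟩
    n * E                      ≡⟨ cong (n *_) m≡E ⟨
    n * m                      ≡⟨ *-comm n m ⟩
    m * n                      ∎

  m≤E : Δ → m ≤ E
  m≤E (inj₁ (_ , hi)) = *-cancelˡ-≤ n (≤-trans (≤-reflexive (*-comm n m)) (≤-trans (m≤m+n (m * n) _) hi))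
  m≤E (inj₂ m≡E)      = ≤-reflexive m≡E

  small : Δ → m ≡ E ⊎ m + 2 * (s * K * k) < D
  small (inj₁ (_ , hi)) = inj₂ (m<D m (≤-trans (≤-reflexive (cong (m * n +_) (i₂ k s E))) hi))
  small (inj₂ m≡E)      = inj₁ m≡E

-- Assembly of the two inclusions

module _ (n k′ r : ℕ) (r<n : r < n) where
  open Counting n k′

  private
    x : Fin n
    x = fromℕ< r<n

    x∉prefix : lookup (prefix n r) x ≡ false
    x∉prefix = trans (lookup-prefix r x) (<ᵇ-false (≤-reflexive (sym (toℕ-fromℕ< r<n))))

    ∣R∣ : ∣ prefix n r ∣ ≡ r
    ∣R∣ = ∣prefix∣ n r (<⇒≤ r<n)

  nK≤kD : n * K ≤ k * D
  nK≤kD = n*K≤ x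

  -- The prefix is just a concrete set of `r` points, with `x` outside it; this frees the estimate
  -- from any particular `R`.
  D≤rK+E : D ≤ r * K + (n ∸ suc r) C k′
  D≤rK+E = subst (λ r → D ≤ r * K + (n ∸ suc r) C k′) ∣R∣ (D≤∣S∣K (prefix n r) x x∉prefix)

  E≤D : (n ∸ suc r) C k′ ≤ D
  E≤D = subst (λ r → (n ∸ suc r) C k′ ≤ D) ∣R∣
    (subst₂ _≤_ (deg-avoid (prefix n r) x x∉prefix) (deg-all x) (deg-mono {avoid (prefix n r)} {all} (λ _ _ → refl) x))

sandwiched : ∀ n k′ r m (let open Counting n k′; s = suc r; E = (n ∸ s) C k′) →
  s < n → Scale n k s m K → 0 < m → m ≤ E → m ≡ E ⊎ m + 2 * (s * K * k) < D →
  ∀ F → IsFamily n k F → length F ≡ sumBinoms n k r + m → AttainsMI n k F →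
  ∀ R → ∣ R ∣ ≡ r → (∀ i j → lookup R i ≡ true → lookup R j ≡ false → deg (mem F) j ≤ deg (mem F) i) →
  SandwichedUpToIso n k r F
sandwiched n k′ _ m s<n scale 0<m m≤E small F isF ∣F∣ maxF R refl R-top
  with argmax-∉ R (Counting.deg n k′ (λ A → mem F A ∧ not (hit R A))) (<⇒≤ s<n) | align ∣ R ∣ R refl
... | x , x∉R , x-top | σ , σ-R with align-insert σ R x σ-R x∉R (<⇒≤ s<n)
...   | τ , τ-R , τ-Rx = τ , inner , outer
  where
  open Counting n k′

  p : Fam
  p = mem F

  F≈p : Represents F p
  F≈p = mem-represents isF

  optimal : Optimal p
  optimal = attainsMI⇒optimal n k′ F p F≈p maxF

  #p : # p ≡ # (hit R) + m
  #p = trans (sym (length-# n k′ F p F≈p)) (trans ∣F∣ (cong (_+ m) (sym (#-hit R))))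

  full : ∀ B → B ∈ₗ U → hit R B ≡ true → p B ≡ true
  full = Extremal.Structure.Large.R-full n k′ p optimal R x m #p x∉R R-top x-top scale 0<m m≤E small

  covered : ∀ A → A ∈ₗ U → p A ≡ true → hit (insert x R) A ≡ true
  covered = Extremal.Structure.Large.cover n k′ p optimal R x m #p x∉R R-top x-top scale 0<m m≤E

  inner : ∀ B → InL n k 1 ∣ R ∣ B → ∃[ A ] (A ∈ₗ F × image τ A ≡ B)
  inner B B∈L with InL⁻ n k′ ∣ R ∣ (<⇒≤ s<n) B∈L
  ... | ∣B∣ , hB = A , mem⁻ F (full A (∈-kSubsets⁺ (trans (∣image∣ (flip τ) B) ∣B∣))
          (trans (sym (hit-image τ {R} τ-R A)) (trans (cong (hit (prefix n ∣ R ∣)) (image-flip τ B)) hB))) , image-flip τ B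
    where A = image (flip τ) B

  outer : ∀ A → A ∈ₗ F → InL n k 1 (suc ∣ R ∣) (image τ A)
  outer A A∈F = InL⁺ n k′ (suc ∣ R ∣) s<n (trans (∣image∣ τ A) ∣A∣)
    (trans (hit-image τ {insert x R} τ-Rx A) (covered A (∈-kSubsets⁺ ∣A∣) (mem⁺ A∈F)))
    where ∣A∣ = All.lookup (proj₂ isF) A∈F

theorem1p2 : (C₀ : ℕ) → 3000 ≤ C₀ →
    (k r n : ℕ) → 2 ≤ k →
    C₀ * (suc r ^ 3) * (k + r) * (k ^ 2) ≤ n →
    (m : ℕ) →
    ((150 * k ^ 3 * suc r ^ 2 * ((n ∸ suc r) C (k ∸ 1)) ≤ m * n
       × m * n + 150 * k ^ 3 * suc r ^ 3 * ((n ∸ suc r) C (k ∸ 1)) ≤ n * ((n ∸ suc r) C (k ∸ 1)))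
      ⊎ m ≡ (n ∸ suc r) C (k ∸ 1)) →
    (F : List (Subset n)) → IsFamily n k F →
    length F ≡ sumBinoms n k r + m →
    AttainsMI n k F →
    SandwichedUpToIso n k r F
theorem1p2 C₀ 3000≤C₀ (suc k′) r n _ C₀≤n m δ F isF ∣F∣ maxF =
  let R , v , ∣R∣ , v≤R , ≤v = largest (Counting.deg n k′ (mem F)) r (<⇒≤ r<n)
      scale , 0<m , m≤E , small = parameters 3000≤C₀ C₀≤n δ (nK≤kD n k′ r r<n) (D≤rK+E n k′ r r<n) (E≤D n k′ r r<n) 0<E
  in sandwiched n k′ r m s<n scale 0<m m≤E small F isF ∣F∣ maxF R ∣R∣ λ i j i∈R j∉R → ≤-trans (≤v j j∉R) (v≤R i i∈R)
  where
  k+s : suc k′ + suc r ≤ n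
  k+s = k+s≤n (suc k′) r (3000k³s³≤n C₀ (suc k′) r 3000≤C₀ C₀≤n)

  s<n : suc r < n
  s<n = ≤-trans (s≤s (m≤n+m (suc r) k′)) k+s

  r<n : r < n
  r<n = <⇒≤ s<n

  0<E : 0 < (n ∸ suc r) C k′
  0<E = nCk>0 (n ∸ suc r) k′ (≤-trans (≤-reflexive (sym (m+n∸n≡m k′ (suc r)))) (∸-monoˡ-≤ (suc r) (<⇒≤ k+s)))
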